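{- For $n\ge 6$, the chromatic symmetric function $X_{P_{n,v,w}}$ of the path $P_n$ twinned at both leaves $v,w$ satisfies the recurrence $$\frac14X_{P_{n,v,w}}=\frac14\sum_{j=3}^{n-3}(j-1)e_jX_{P_{n-j,v,w}}+(n+2)e_{n+2}+n\,e_{n+1}e_1+3(n-2)e_{n-1}e_3+2(n-3)e_{n-2}e_3e_1+4(n-3)e_{n-2}e_4$$ $$\qquad+e_2\Bigl[\frac14X_{P_{n-2,v,w}}-2e_n-(n-4)e_{n-2}e_2-(n-2)e_{n-1}e_1\Bigr],$$ with the initial conditions $X_{P_{2,v,w}}=24e_4$, $X_{P_{3,v,w}}=4e_3e_2+12e_4e_1+20e_5$, $X_{P_{4,v,w}}=24e_3^2+8e_4e_2+16e_5e_1+24e_6$, $X_{P_{5,v,w}}=16e_3e_3e_1+68e_4e_3+12e_5e_2+20e_6e_1+28e_7$. Moreover, despite the negative terms, the expression on the right-hand side of the recurrence is $e$-positive.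
   Context: The chromatic symmetric function of a finite simple graph $H=(V,E)$ is $X_H=\sum_\kappa\prod_{u\in V}x_{\kappa(u)}$, the sum over all proper colorings $\kappa:V\to\mathbb{Z}_{>0}$. $P_n$ is the path on $n$ vertices. The twin of a graph at a vertex $v$ is obtained by adding a new vertex $v'$ joined to $v$ and to all neighbors of $v$. $P_{n,v,w}$ denotes $P_n$ twinned at its two leaves $v$ and $w$ in succession. $e_i$ is the $i$-th elementary symmetric function; a symmetric function is $e$-positive if its expansion in the basis of elementary symmetric functions has nonnegative coefficients. -}

module Defs where

open import Data.Empty using (⊥)
open import Data.Fin using (Fin; zero; suc; toℕ; fromℕ)
import Data.Fin.Properties as Fin
open import Data.Integer using (+_)
open import Data.List using (List; []; _∷_; map; foldr; filter; length; upTo; allFin; cartesianProductWith)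
open import Data.List.Relation.Unary.All using (All)
open import Data.List.Relation.Unary.Linked using (Linked)
open import Data.List.Relation.Unary.Unique.Propositional using (Unique)
open import Data.Nat using (ℕ; zero; suc; _+_; _∸_; _≤_; _≥_; _≤?_; _≟_)
open import Data.Nat.Properties using (1+n≢n)
open import Data.Product using (Σ; _×_; proj₁; proj₂)
open import Data.Rational using (ℚ; 0ℚ; 1ℚ; _/_) renaming (_+_ to _+ℚ_; _*_ to _*ℚ_; _-_ to _-ℚ_; _≤_ to _≤ℚ_)
open import Data.Sum using (_⊎_; inj₁; inj₂; swap)
open import Data.Vec using (Vec; []; _∷_; lookup; tabulate; count; zipWith; sum)
import Data.Vec.Properties as Vec
import Data.Vec.Relation.Unary.All as VecAll
open import Function using (_∘_)
open import Relation.Binary.PropositionalEquality using (_≡_; _≢_)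
open import Relation.Nullary using (¬_; Dec; no)
open import Relation.Nullary.Decidable using (_×-dec_; _⊎-dec_; _→-dec_; ¬?; does)
open import Data.Bool using (if_then_else_)

record Graph : Set₁ where
  field
    order  : ℕ
    Adj    : Fin order → Fin order → Set
    adj?   : ∀ i j → Dec (Adj i j)
    symm   : ∀ {i j} → Adj i j → Adj j i
    irrefl : ∀ {i} → ¬ Adj i i

open Graph public

path : ℕ → Graph
path n = record
  { order  = n
  ; Adj    = λ i j → suc (toℕ i) ≡ toℕ j ⊎ suc (toℕ j) ≡ toℕ i
  ; adj?   = λ i j → (suc (toℕ i) ≟ toℕ j) ⊎-dec (suc (toℕ j) ≟ toℕ i)
  ; symm   = swap
  ; irrefl = λ { (inj₁ p) → 1+n≢n p ; (inj₂ p) → 1+n≢n p }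
  }

-- In the twin of G at v, `zero` is the new vertex v′ and `suc u` is the old
-- vertex u.

TwinAdj : (G : Graph) → Fin (order G) → Fin (suc (order G)) → Fin (suc (order G)) → Set
TwinAdj G v zero    zero    = ⊥
TwinAdj G v zero    (suc j) = j ≡ v ⊎ Adj G v j
TwinAdj G v (suc i) zero    = i ≡ v ⊎ Adj G v i
TwinAdj G v (suc i) (suc j) = Adj G i j

twin : (G : Graph) → Fin (order G) → Graph
twin G v = record
  { order  = suc (order G)
  ; Adj    = TwinAdj G v
  ; adj?   = dec
  ; symm   = λ {i} {j} → sy i j
  ; irrefl = λ {i} → irr i
  }
  where
  dec : ∀ i j → Dec (TwinAdj G v i j)
  dec zero    zero    = no λ ()
  dec zero    (suc j) = (j Fin.≟ v) ⊎-dec adj? G v j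
  dec (suc i) zero    = (i Fin.≟ v) ⊎-dec adj? G v i
  dec (suc i) (suc j) = adj? G i j

  sy : ∀ i j → TwinAdj G v i j → TwinAdj G v j i
  sy zero    (suc j) p = p
  sy (suc i) zero    p = p
  sy (suc i) (suc j) p = symm G p

  irr : ∀ i → ¬ TwinAdj G v i i
  irr (suc i) p = irrefl G p

-- P_{n,v,w}.  The leaves of P_n, for n ≥ 2, are the vertices 0 and n − 1; after
-- twinning at the first one, the second one is called `suc (fromℕ m)`.
-- The values at n < 2, where there are no two leaves, are meaningless.

twinnedPath : ℕ → Graph
twinnedPath zero    = path zero
twinnedPath (suc m) = twin (twin (path (suc m)) zero) (suc (fromℕ m))

-- Formal power series in x₁, x₂, … over ℚ:
-- `f m (α₁ ∷ … ∷ αₘ ∷ [])` is the coefficient of x₁^α₁ ⋯ xₘ^αₘ in f.  Appending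
-- zeros to the exponent vector does not change the monomial, so a genuine
-- series takes the same value on both vectors; `e k` and `X G` do, and the
-- operations below preserve this, so it is not recorded in the type.

Series : Set
Series = (m : ℕ) → Vec ℕ m → ℚ

infix 4 _≈_
infixl 6 _⊕_ _⊖_
infixl 7 _⊗_
infixr 8 _•_ _·_

_≈_ : Series → Series → Set
f ≈ g = ∀ m (α : Vec ℕ m) → f m α ≡ g m α

𝟘 𝟙 : Series
𝟘 m α = 0ℚ
𝟙 m α = if does (sum α ≟ 0) then 1ℚ else 0ℚ

_⊕_ _⊖_ _⊗_ : Series → Series → Series
(f ⊕ g) m α = f m α +ℚ g m α
(f ⊖ g) m α = f m α -ℚ g m α

-- All exponent vectors β ≤ α, each once.
divisors : ∀ {m} → Vec ℕ m → List (Vec ℕ m)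
divisors []      = [] ∷ []
divisors (a ∷ α) = cartesianProductWith _∷_ (upTo (suc a)) (divisors α)

(f ⊗ g) m α = foldr _+ℚ_ 0ℚ (map (λ β → f m β *ℚ g m (zipWith _∸_ α β)) (divisors α))

_•_ : ℚ → Series → Series
(c • f) m α = c *ℚ f m α

_·_ : ℕ → Series → Series
k · f = (+ k / 1) • f

¼ : ℚ
¼ = + 1 / 4

-- Σ[ a ⋯ b ] f is f a ⊕ f (a + 1) ⊕ … ⊕ f b.
Σ[_⋯_] : ℕ → ℕ → (ℕ → Series) → Series
Σ[ a ⋯ b ] f = foldr _⊕_ 𝟘 (map (λ i → f (a + i)) (upTo (suc b ∸ a)))

-- The sum of all squarefree monomials of degree k.
e : ℕ → Series
e k m α = if does (VecAll.all? (_≤? 1) α ×-dec (sum α ≟ k)) then 1ℚ else 0ℚ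

record Partition : Set where
  field
    parts      : List ℕ
    decreasing : Linked _≥_ parts
    positive   : All (1 ≤_) parts

open Partition public

e[_] : Partition → Series
e[ μ ] = foldr _⊗_ 𝟙 (map e (parts μ))

combination : List (ℚ × Partition) → Series
combination c = foldr _⊕_ 𝟘 (map (λ t → proj₁ t • e[ proj₂ t ]) c)

-- Distinctness makes the entries of c the coefficients of f in the e-basis.
IsEExpansion : Series → List (ℚ × Partition) → Set
IsEExpansion f c = Unique (map (parts ∘ proj₂) c) × f ≈ combination c

EPositive : Series → Set
EPositive f = Σ (List (ℚ × Partition)) λ c → IsEExpansion f c × All (λ t → 0ℚ ≤ℚ proj₁ t) c

colorings : (m k : ℕ) → List (Vec (Fin m) k)
colorings m zero    = [] ∷ []
colorings m (suc k) = cartesianProductWith _∷_ (allFin m) (colorings m k)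

Proper : (G : Graph) {m : ℕ} → Vec (Fin m) (order G) → Set
Proper G κ = ∀ i j → Adj G i j → lookup κ i ≢ lookup κ j

proper? : (G : Graph) {m : ℕ} (κ : Vec (Fin m) (order G)) → Dec (Proper G κ)
proper? G κ = Fin.all? λ i → Fin.all? λ j → adj? G i j →-dec ¬? (lookup κ i Fin.≟ lookup κ j)

-- The exponent vector of the monomial ∏ᵤ x_{κ(u)}.
content : ∀ {m k} → Vec (Fin m) k → Vec ℕ m
content κ = tabulate λ i → count (i Fin.≟_) κ

-- The coefficient of x₁^α₁ ⋯ xₘ^αₘ in Σ_κ ∏ᵤ x_{κ(u)}: only colorings with
-- colors among the first m can contribute to it.
X : Graph → Series
X G m α = + length (filter (λ κ → proper? G κ ×-dec Vec.≡-dec _≟_ (content κ) α) (colorings m (order G))) / 1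

{-# OPTIONS --safe #-}

-- A proper coloring of a path is a walk on colors that changes color at every step.  In finitely many variables, the
-- weights w(n, j) of the walks with n vertices ending in color j satisfy w(n+1) = T w(n) for the operator
-- (T f)(j) = x_j (Σ f - f(j)), and their sums S(n) = X_{P_n} satisfy S(n) = e_n + Σ_{j≥2} (j-1) e_j S(n-j).  The twin of
-- a leaf completes a triangle, which contributes the factor 2 e_2(all variables but x_j), j being the color of the
-- neighbor of the leaf.  Since Σ_j e_2(all variables but x_j) f(j) = Σ T²f - e_2 Σ f for every f, one gets, for n ≥ 3,
--   ¼ X_{P_{n,v,w}} = S(n+2) - 2 e_2 S(n) + e_2² S(n-2),
-- and the recurrence follows from that of S.  For positivity, write
--   ¼ X_{P_{n,v,w}} = C(n) + (n+2) e_{n+2} + (n-2) e_n e_2 + n e_{n+1} e_1;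
-- the resulting recurrence for C has no negative terms.

module Submission where

open import Algebra.Bundles using (CommutativeMonoid; CommutativeRing; RawRing)
import Algebra.Consequences.Setoid as Consequences
import Algebra.Construct.Pointwise as Pointwise
open import Algebra.Solver.Ring.AlmostCommutativeRing using (fromCommutativeRing; _-Raw-AlmostCommutative⟶_)
open import Data.Bool using (true; false; if_then_else_; _∧_)
open import Data.Fin using (Fin; zero; suc)
import Data.Fin.Properties as Fin
import Data.Integer as ℤ
import Data.Integer.Properties as ℤ
open import Data.List using (List; []; _∷_; _++_; map; foldr; cartesianProductWith)
import Data.Maybe as Maybe
open import Data.Nat using (ℕ; zero; suc)
import Data.Nat as ℕ
open import Data.Product using (_,_)
open import Data.Rational using (ℚ; _/_)
import Data.Rational as ℚ using (toℚᵘ; _+_; _*_)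
import Data.Rational.Properties as ℚ
open import Data.Rational.Unnormalised using (mkℚᵘ; *≡*)
import Data.Rational.Unnormalised as ℚᵘ using (_+_; _*_)
import Data.Rational.Unnormalised.Properties as ℚᵘ
open import Data.Vec using (Vec; []; _∷_)
open import Function using (_∘_)
open import Level using (0ℓ)
import Relation.Binary.PropositionalEquality as ≡
open import Relation.Nullary using (Dec; does; yes; no)
open import Relation.Nullary.Decidable using (dec⇒maybe)

module ListSum {c ℓ} (M : CommutativeMonoid c ℓ) where

  open CommutativeMonoid M

  ∑ᴸ : ∀ {a} {A : Set a} → (A → Carrier) → List A → Carrier
  ∑ᴸ f xs = foldr _∙_ ε (map f xs)

  ∑ᴸ-++ : ∀ {a} {A : Set a} (f : A → Carrier) xs ys → ∑ᴸ f (xs ++ ys) ≈ ∑ᴸ f xs ∙ ∑ᴸ f ys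
  ∑ᴸ-++ f []       ys = sym (identityˡ _)
  ∑ᴸ-++ f (x ∷ xs) ys = trans (∙-congˡ (∑ᴸ-++ f xs ys)) (sym (assoc _ _ _))

  ∑ᴸ-map : ∀ {a b} {A : Set a} {B : Set b} (f : B → Carrier) (g : A → B) xs →
           ∑ᴸ f (map g xs) ≈ ∑ᴸ (f ∘ g) xs
  ∑ᴸ-map f g []       = refl
  ∑ᴸ-map f g (x ∷ xs) = ∙-congˡ (∑ᴸ-map f g xs)

  ∑ᴸ-product : ∀ {a b d} {A : Set a} {B : Set b} {D : Set d}
               (f : D → Carrier) (g : A → B → D) xs ys →
               ∑ᴸ f (cartesianProductWith g xs ys) ≈ ∑ᴸ (λ x → ∑ᴸ (λ y → f (g x y)) ys) xs
  ∑ᴸ-product f g []       ys = refl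
  ∑ᴸ-product f g (x ∷ xs) ys =
    trans (∑ᴸ-++ f (map (g x) ys) _) (∙-cong (∑ᴸ-map f (g x) ys) (∑ᴸ-product f g xs ys))

module CauchyProduct {c ℓ} (R : CommutativeRing c ℓ) where

  open CommutativeRing R
  open import Relation.Binary.Reasoning.Setoid setoid
  open import Algebra.Properties.CommutativeSemigroup +-commutativeSemigroup using (interchange)

  PowerSeries : Set c
  PowerSeries = ℕ → Carrier

  infix 4 _≋_
  _≋_ : PowerSeries → PowerSeries → Set ℓ
  f ≋ g = ∀ n → f n ≈ g n

  conv : PowerSeries → PowerSeries → PowerSeries
  conv f g zero    = f 0 * g 0
  conv f g (suc n) = f 0 * g (suc n) + conv (f ∘ suc) g n

  constant : Carrier → PowerSeries
  constant a zero    = a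
  constant a (suc n) = 0#

  shift : PowerSeries → PowerSeries
  shift f zero    = 0#
  shift f (suc n) = f n

  conv-cong : ∀ {f f′ g g′} → f ≋ f′ → g ≋ g′ → conv f g ≋ conv f′ g′
  conv-cong p q zero    = *-cong (p 0) (q 0)
  conv-cong p q (suc n) = +-cong (*-cong (p 0) (q (suc n))) (conv-cong (p ∘ suc) q n)

  conv-zeroˡ : ∀ g → conv (λ _ → 0#) g ≋ λ _ → 0#
  conv-zeroˡ g zero    = zeroˡ (g 0)
  conv-zeroˡ g (suc n) = trans (+-cong (zeroˡ _) (conv-zeroˡ g n)) (+-identityˡ 0#)

  conv-constantˡ : ∀ a g → conv (constant a) g ≋ λ n → a * g n
  conv-constantˡ a g zero    = refl
  conv-constantˡ a g (suc n) = trans (+-congˡ (conv-zeroˡ g n)) (+-identityʳ _)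

  conv-shiftˡ : ∀ f g → conv (shift f) g ≋ shift (conv f g)
  conv-shiftˡ f g zero    = zeroˡ _
  conv-shiftˡ f g (suc n) = trans (+-congʳ (zeroˡ _)) (+-identityˡ _)

  conv-last : ∀ f g n → conv f g (suc n) ≈ conv f (g ∘ suc) n + f (suc n) * g 0
  conv-last f g zero    = refl
  conv-last f g (suc n) = begin
    f 0 * g (suc (suc n)) + conv (f ∘ suc) g (suc n)
      ≈⟨ +-congˡ (conv-last (f ∘ suc) g n) ⟩
    f 0 * g (suc (suc n)) + (conv (f ∘ suc) (g ∘ suc) n + f (suc (suc n)) * g 0)
      ≈⟨ +-assoc _ _ _ ⟨
    f 0 * g (suc (suc n)) + conv (f ∘ suc) (g ∘ suc) n + f (suc (suc n)) * g 0 ∎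

  conv-comm : ∀ f g → conv f g ≋ conv g f
  conv-comm f g zero    = *-comm _ _
  conv-comm f g (suc n) = begin
    f 0 * g (suc n) + conv (f ∘ suc) g n   ≈⟨ +-cong (*-comm _ _) (conv-comm (f ∘ suc) g n) ⟩
    g (suc n) * f 0 + conv g (f ∘ suc) n   ≈⟨ +-comm _ _ ⟩
    conv g (f ∘ suc) n + g (suc n) * f 0   ≈⟨ conv-last g f n ⟨
    conv g f (suc n)                       ∎

  conv-distribʳ : ∀ h f g → conv (λ n → f n + g n) h ≋ λ n → conv f h n + conv g h n
  conv-distribʳ h f g zero    = distribʳ _ _ _
  conv-distribʳ h f g (suc n) =
    trans (+-cong (distribʳ _ _ _) (conv-distribʳ h (f ∘ suc) (g ∘ suc) n)) (interchange _ _ _ _)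

  conv-distribˡ : ∀ h f g → conv h (λ n → f n + g n) ≋ λ n → conv h f n + conv h g n
  conv-distribˡ h f g n = begin
    conv h (λ k → f k + g k) n   ≈⟨ conv-comm h _ n ⟩
    conv (λ k → f k + g k) h n   ≈⟨ conv-distribʳ h f g n ⟩
    conv f h n + conv g h n      ≈⟨ +-cong (conv-comm f h n) (conv-comm g h n) ⟩
    conv h f n + conv h g n      ∎

  conv-*ˡ : ∀ a f g → conv (λ n → a * f n) g ≋ λ n → a * conv f g n
  conv-*ˡ a f g zero    = *-assoc _ _ _
  conv-*ˡ a f g (suc n) = trans (+-cong (*-assoc _ _ _) (conv-*ˡ a (f ∘ suc) g n)) (sym (distribˡ _ _ _))

  conv-*ʳ : ∀ a f g → conv f (λ n → a * g n) ≋ λ n → a * conv f g n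
  conv-*ʳ a f g n =
    trans (conv-comm f _ n) (trans (conv-*ˡ a g f n) (*-congˡ (conv-comm g f n)))

  conv-assoc : ∀ f g h → conv (conv f g) h ≋ conv f (conv g h)
  conv-assoc f g h zero    = *-assoc _ _ _
  conv-assoc f g h (suc n) = begin
    f 0 * g 0 * h (suc n) + conv (λ k → f 0 * g (suc k) + conv (f ∘ suc) g k) h n
      ≈⟨ +-cong (*-assoc _ _ _) (conv-distribʳ h _ _ n) ⟩
    f 0 * (g 0 * h (suc n)) + (conv (λ k → f 0 * g (suc k)) h n + conv (conv (f ∘ suc) g) h n)
      ≈⟨ +-congˡ (+-cong (conv-*ˡ _ _ h n) (conv-assoc (f ∘ suc) g h n)) ⟩
    f 0 * (g 0 * h (suc n)) + (f 0 * conv (g ∘ suc) h n + conv (f ∘ suc) (conv g h) n)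
      ≈⟨ +-assoc _ _ _ ⟨
    f 0 * (g 0 * h (suc n)) + f 0 * conv (g ∘ suc) h n + conv (f ∘ suc) (conv g h) n
      ≈⟨ +-congʳ (distribˡ _ _ _) ⟨
    f 0 * conv g h (suc n) + conv (f ∘ suc) (conv g h) n ∎

  powerSeriesRing : CommutativeRing c ℓ
  powerSeriesRing = record
    { Carrier           = PowerSeries
    ; _≈_               = _≋_
    ; _+_               = λ f g n → f n + g n
    ; _*_               = conv
    ; -_                = λ f n → - f n
    ; 0#                = λ _ → 0#
    ; 1#                = constant 1#
    ; isCommutativeRing = record
      { isRing = record
        { +-isAbelianGroup = Pointwise.isAbelianGroup ℕ +-isAbelianGroup
        ; *-cong           = conv-cong
        ; *-assoc          = conv-assoc
        ; *-identity       = identityˡ , λ f n → trans (conv-comm f (constant 1#) n) (identityˡ f n)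
        ; distrib          = conv-distribˡ , conv-distribʳ
        }
      ; *-comm = conv-comm
      }
    }
    where
    identityˡ : ∀ f → conv (constant 1#) f ≋ f
    identityˡ f n = trans (conv-constantˡ 1# f n) (*-identityˡ (f n))

ℚ-rawRing : RawRing 0ℓ 0ℓ
ℚ-rawRing = CommutativeRing.rawRing ℚ.+-*-commutativeRing

ℕ⇒ℚ : ℕ → ℚ
ℕ⇒ℚ n = ℤ.+ n / 1

ℕ⇒ℚ-+ : ∀ a b → ℕ⇒ℚ (a ℕ.+ b) ≡.≡ ℕ⇒ℚ a ℚ.+ ℕ⇒ℚ b
ℕ⇒ℚ-+ a b = ℚ.toℚᵘ-injective (begin
  ℚ.toℚᵘ (ℕ⇒ℚ (a ℕ.+ b))                  ≈⟨ ℚ.toℚᵘ-fromℚᵘ (mkℚᵘ (ℤ.+ (a ℕ.+ b)) 0) ⟩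
  mkℚᵘ (ℤ.+ (a ℕ.+ b)) 0                    ≈⟨ *≡* (≡.cong (ℤ._* ℤ.1ℤ) (≡.sym (≡.cong₂ ℤ._+_ (ℤ.*-identityʳ (ℤ.+ a)) (ℤ.*-identityʳ (ℤ.+ b))))) ⟩
  mkℚᵘ (ℤ.+ a) 0 ℚᵘ.+ mkℚᵘ (ℤ.+ b) 0        ≈⟨ ℚᵘ.+-cong (ℚ.toℚᵘ-fromℚᵘ (mkℚᵘ (ℤ.+ a) 0)) (ℚ.toℚᵘ-fromℚᵘ (mkℚᵘ (ℤ.+ b) 0)) ⟨
  ℚ.toℚᵘ (ℕ⇒ℚ a) ℚᵘ.+ ℚ.toℚᵘ (ℕ⇒ℚ b)    ≈⟨ ℚ.toℚᵘ-homo-+ (ℕ⇒ℚ a) (ℕ⇒ℚ b) ⟨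
  ℚ.toℚᵘ (ℕ⇒ℚ a ℚ.+ ℕ⇒ℚ b)              ∎)
  where open import Relation.Binary.Reasoning.Setoid ℚᵘ.≃-setoid

ℕ⇒ℚ-* : ∀ a b → ℕ⇒ℚ (a ℕ.* b) ≡.≡ ℕ⇒ℚ a ℚ.* ℕ⇒ℚ b
ℕ⇒ℚ-* a b = ℚ.toℚᵘ-injective (begin
  ℚ.toℚᵘ (ℕ⇒ℚ (a ℕ.* b))                  ≈⟨ ℚ.toℚᵘ-fromℚᵘ (mkℚᵘ (ℤ.+ (a ℕ.* b)) 0) ⟩
  mkℚᵘ (ℤ.+ (a ℕ.* b)) 0                    ≈⟨ *≡* (≡.cong (ℤ._* ℤ.1ℤ) (ℤ.pos-* a b)) ⟩
  mkℚᵘ (ℤ.+ a) 0 ℚᵘ.* mkℚᵘ (ℤ.+ b) 0        ≈⟨ ℚᵘ.*-cong (ℚ.toℚᵘ-fromℚᵘ (mkℚᵘ (ℤ.+ a) 0)) (ℚ.toℚᵘ-fromℚᵘ (mkℚᵘ (ℤ.+ b) 0)) ⟨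
  ℚ.toℚᵘ (ℕ⇒ℚ a) ℚᵘ.* ℚ.toℚᵘ (ℕ⇒ℚ b)    ≈⟨ ℚ.toℚᵘ-homo-* (ℕ⇒ℚ a) (ℕ⇒ℚ b) ⟨
  ℚ.toℚᵘ (ℕ⇒ℚ a ℚ.* ℕ⇒ℚ b)              ∎)
  where open import Relation.Binary.Reasoning.Setoid ℚᵘ.≃-setoid

module Chromatic (R : CommutativeRing 0ℓ 0ℓ)
                 (morphism : ℚ-rawRing -Raw-AlmostCommutative⟶ fromCommutativeRing R) where

  open CommutativeRing R hiding (zero)
  open _-Raw-AlmostCommutative⟶_ morphism using (+-homo; *-homo; 0-homo) renaming (⟦_⟧ to scalar)
  open import Relation.Binary.Reasoning.Setoid setoid
  open import Algebra.Properties.CommutativeMonoid.Sum +-commutativeMonoid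
    using (∑-distrib-+; ∑-comm) renaming (sum to ∑; sum-cong-≋ to ∑-cong; sum-replicate-zero to ∑-zero)
  open import Algebra.Properties.Semiring.Sum semiring using (*-distribˡ-sum; *-distribʳ-sum)
  open import Algebra.Solver.Ring ℚ-rawRing (fromCommutativeRing R) morphism
    (λ p q → Maybe.map (reflexive ∘ ≡.cong scalar) (dec⇒maybe (p ℚ.≟ q)))
  open CauchyProduct R

  num : ℕ → Carrier
  num n = scalar (ℕ⇒ℚ n)

  n : ∀ {j} → ℕ → Polynomial j
  n i = con (ℕ⇒ℚ i)

  num-+ : ∀ a b → num (a ℕ.+ b) ≈ num a + num b
  num-+ a b = trans (reflexive (≡.cong scalar (ℕ⇒ℚ-+ a b))) (+-homo (ℕ⇒ℚ a) (ℕ⇒ℚ b))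

  num-* : ∀ a b → num (a ℕ.* b) ≈ num a * num b
  num-* a b = trans (reflexive (≡.cong scalar (ℕ⇒ℚ-* a b))) (*-homo (ℕ⇒ℚ a) (ℕ⇒ℚ b))

  ∑-distrib-- : ∀ {n} (f g : Fin n → Carrier) → ∑ (λ i → f i - g i) ≈ ∑ f - ∑ g
  ∑-distrib-- {zero}  f g = sym (-‿inverseʳ 0#)
  ∑-distrib-- {suc n} f g = trans (+-congˡ (∑-distrib-- (f ∘ suc) (g ∘ suc)))
    (solve 4 (λ a b c d → (a :- b) :+ (c :- d) := (a :+ c) :- (b :+ d)) refl
      (f zero) (g zero) (∑ (f ∘ suc)) (∑ (g ∘ suc)))

  conv-∑ʳ : ∀ {m} f (g : Fin m → PowerSeries) n → ∑ (λ i → conv f (g i) n) ≈ conv f (λ k → ∑ (λ i → g i k)) n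
  conv-∑ʳ f g zero    = sym (*-distribˡ-sum (f 0) (λ i → g i 0))
  conv-∑ʳ f g (suc n) = trans (∑-distrib-+ (λ i → f 0 * g i (suc n)) (λ i → conv (f ∘ suc) (g i) n))
    (+-cong (sym (*-distribˡ-sum (f 0) (λ i → g i (suc n)))) (conv-∑ʳ (f ∘ suc) g n))

  conv-∑ˡ : ∀ {m} (f : Fin m → PowerSeries) g n → ∑ (λ i → conv (f i) g n) ≈ conv (λ k → ∑ (λ i → f i k)) g n
  conv-∑ˡ f g n = begin
    ∑ (λ i → conv (f i) g n)           ≈⟨ ∑-cong (λ i → conv-comm (f i) g n) ⟩
    ∑ (λ i → conv g (f i) n)           ≈⟨ conv-∑ʳ g f n ⟩
    conv g (λ k → ∑ (λ i → f i k)) n   ≈⟨ conv-comm g _ n ⟩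
    conv (λ k → ∑ (λ i → f i k)) g n   ∎

  distinct : ∀ {m} → Fin m → Fin m → Carrier
  distinct i j = if does (i Fin.≟ j) then 0# else 1#

  distinct-sym : ∀ {m} (i j : Fin m) → distinct i j ≈ distinct j i
  distinct-sym zero    zero    = refl
  distinct-sym zero    (suc j) = refl
  distinct-sym (suc i) zero    = refl
  distinct-sym (suc i) (suc j) = distinct-sym i j

  distinct-idem : ∀ {m} (i j : Fin m) → distinct i j * distinct i j ≈ distinct i j
  distinct-idem i j with i Fin.≟ j
  ... | yes _ = zeroˡ 0#
  ... | no  _ = *-identityˡ 1#

  ∑-distinct : ∀ {m} (i : Fin m) f → ∑ (λ j → distinct i j * f j) ≈ ∑ f - f i
  ∑-distinct zero f = begin
    0# * f zero + ∑ (λ j → 1# * f (suc j))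
      ≈⟨ trans (+-cong (zeroˡ _) (∑-cong (λ j → *-identityˡ (f (suc j))))) (+-identityˡ _) ⟩
    ∑ (f ∘ suc)
      ≈⟨ solve 2 (λ a b → b := (a :+ b) :- a) refl (f zero) (∑ (f ∘ suc)) ⟩
    f zero + ∑ (f ∘ suc) - f zero ∎
  ∑-distinct (suc i) f = begin
    1# * f zero + ∑ (λ j → distinct i j * f (suc j))
      ≈⟨ +-cong (*-identityˡ _) (∑-distinct i (f ∘ suc)) ⟩
    f zero + (∑ (f ∘ suc) - f (suc i))
      ≈⟨ +-assoc _ _ _ ⟨
    f zero + ∑ (f ∘ suc) - f (suc i) ∎

  ∑-* : ∀ {m} a (f : Fin m → Carrier) → ∑ (λ i → a * f i) ≈ a * ∑ f
  ∑-* a f = sym (*-distribˡ-sum a f)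

  ∑-snoc : ∀ {m} {u : Fin m → Carrier} {U} a f → ∑ u ≈ U → ∑ (λ i → u i + a * f i) ≈ U + a * ∑ f
  ∑-snoc {u = u} a f p = trans (∑-distrib-+ u (λ i → a * f i)) (+-cong p (∑-* a f))

  module ElementarySymmetric {m : ℕ} (x : Fin m → Carrier) (e : ℕ → Carrier) (ē : ℕ → Fin m → Carrier)
    (e-zero  : e 0 ≈ 1#)
    (ē-zero  : ∀ i → ē 0 i ≈ 1#)
    (e-split : ∀ k i → e (suc k) ≈ ē (suc k) i + x i * ē k i)
    (e-sum   : ∀ k → ∑ (λ i → x i * ē k i) ≈ num (suc k) * e (suc k))
    where

    ē-suc : ∀ k i → ē (suc k) i ≈ e (suc k) - x i * ē k i
    ē-suc k i = begin
      ē (suc k) i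
        ≈⟨ solve 2 (λ a b → a := a :+ b :- b) refl (ē (suc k) i) (x i * ē k i) ⟩
      ē (suc k) i + x i * ē k i - x i * ē k i
        ≈⟨ +-congʳ (e-split k i) ⟨
      e (suc k) - x i * ē k i ∎

    ē₁ : ∀ i → ē 1 i ≈ e 1 - x i
    ē₁ i = trans (ē-suc 0 i) (+-congˡ (-‿cong (trans (*-congˡ (ē-zero i)) (*-identityʳ _))))

    ē₂ : ∀ i → ē 2 i ≈ e 2 - e 1 * x i + x i * x i
    ē₂ i = trans (ē-suc 1 i) (trans (+-congˡ (-‿cong (*-congˡ (ē₁ i))))
      (solve 3 (λ a b x → b :- x :* (a :- x) := b :- a :* x :+ x :* x) refl (e 1) (e 2) (x i)))

    ē₃ : ∀ i → ē 3 i ≈ e 3 - e 2 * x i + e 1 * (x i * x i) - x i * x i * x i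
    ē₃ i = trans (ē-suc 2 i) (trans (+-congˡ (-‿cong (*-congˡ (ē₂ i))))
      (solve 4 (λ a b c x → c :- x :* (b :- a :* x :+ x :* x) := c :- b :* x :+ a :* (x :* x) :- x :* x :* x)
        refl (e 1) (e 2) (e 3) (x i)))

    p₂ p₃ p₄ : Carrier
    p₂ = ∑ (λ i → x i * x i)
    p₃ = ∑ (λ i → x i * x i * x i)
    p₄ = ∑ (λ i → x i * x i * x i * x i)

    num-1 : ∀ a → num 1 * a ≈ a
    num-1 = solve 1 (λ a → con (ℕ⇒ℚ 1) :* a := a) refl

    newton₁ : ∑ x ≈ e 1
    newton₁ = begin
      ∑ x                      ≈⟨ ∑-cong (λ i → trans (*-congˡ (ē-zero i)) (*-identityʳ _)) ⟨
      ∑ (λ i → x i * ē 0 i)    ≈⟨ e-sum 0 ⟩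
      num 1 * e 1              ≈⟨ num-1 (e 1) ⟩
      e 1                      ∎

    newton₂ : num 2 * e 2 ≈ e 1 * e 1 - p₂
    newton₂ = begin
      num 2 * e 2                                 ≈⟨ e-sum 1 ⟨
      ∑ (λ i → x i * ē 1 i)                       ≈⟨ ∑-cong (λ i → trans (*-congˡ (ē₁ i))
        (solve 2 (λ a x → x :* (a :- x) := a :* x :+ (:- con (ℕ⇒ℚ 1)) :* (x :* x)) refl (e 1) (x i))) ⟩
      ∑ (λ i → e 1 * x i + - num 1 * (x i * x i)) ≈⟨ ∑-snoc (- num 1) (λ i → x i * x i) (∑-* (e 1) x) ⟩
      e 1 * ∑ x + - num 1 * p₂                    ≈⟨ +-congʳ (*-congˡ newton₁) ⟩
      e 1 * e 1 + - num 1 * p₂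
        ≈⟨ solve 2 (λ a p → a :* a :+ (:- con (ℕ⇒ℚ 1)) :* p := a :* a :- p) refl (e 1) p₂ ⟩
      e 1 * e 1 - p₂                              ∎

    newton₃ : num 3 * e 3 ≈ e 2 * e 1 - e 1 * p₂ + p₃
    newton₃ = begin
      num 3 * e 3                                 ≈⟨ e-sum 2 ⟨
      ∑ (λ i → x i * ē 2 i)                       ≈⟨ ∑-cong (λ i → trans (*-congˡ (ē₂ i))
        (solve 3 (λ a b x → x :* (b :- a :* x :+ x :* x)
                         := b :* x :+ (:- a) :* (x :* x) :+ con (ℕ⇒ℚ 1) :* (x :* x :* x))
          refl (e 1) (e 2) (x i))) ⟩
      ∑ (λ i → e 2 * x i + - e 1 * (x i * x i) + num 1 * (x i * x i * x i))
        ≈⟨ ∑-snoc (num 1) (λ i → x i * x i * x i) (∑-snoc (- e 1) (λ i → x i * x i) (∑-* (e 2) x)) ⟩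
      e 2 * ∑ x + - e 1 * p₂ + num 1 * p₃         ≈⟨ +-congʳ (+-congʳ (*-congˡ newton₁)) ⟩
      e 2 * e 1 + - e 1 * p₂ + num 1 * p₃
        ≈⟨ solve 4 (λ a b p q → b :* a :+ (:- a) :* p :+ con (ℕ⇒ℚ 1) :* q := b :* a :- a :* p :+ q)
             refl (e 1) (e 2) p₂ p₃ ⟩
      e 2 * e 1 - e 1 * p₂ + p₃                   ∎

    newton₄ : num 4 * e 4 ≈ e 3 * e 1 - e 2 * p₂ + e 1 * p₃ - p₄
    newton₄ = begin
      num 4 * e 4                                 ≈⟨ e-sum 3 ⟨
      ∑ (λ i → x i * ē 3 i)                       ≈⟨ ∑-cong (λ i → trans (*-congˡ (ē₃ i))
        (solve 4 (λ a b c x → x :* (c :- b :* x :+ a :* (x :* x) :- x :* x :* x)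
                         := c :* x :+ (:- b) :* (x :* x) :+ a :* (x :* x :* x)
                              :+ (:- con (ℕ⇒ℚ 1)) :* (x :* x :* x :* x))
          refl (e 1) (e 2) (e 3) (x i))) ⟩
      ∑ (λ i → e 3 * x i + - e 2 * (x i * x i) + e 1 * (x i * x i * x i) + - num 1 * (x i * x i * x i * x i))
        ≈⟨ ∑-snoc (- num 1) (λ i → x i * x i * x i * x i) (∑-snoc (e 1) (λ i → x i * x i * x i) (∑-snoc (- e 2) (λ i → x i * x i) (∑-* (e 3) x))) ⟩
      e 3 * ∑ x + - e 2 * p₂ + e 1 * p₃ + - num 1 * p₄
        ≈⟨ +-congʳ (+-congʳ (+-congʳ (*-congˡ newton₁))) ⟩
      e 3 * e 1 + - e 2 * p₂ + e 1 * p₃ + - num 1 * p₄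
        ≈⟨ solve 6 (λ a b c p q r → c :* a :+ (:- b) :* p :+ a :* q :+ (:- con (ℕ⇒ℚ 1)) :* r
                                 := c :* a :- b :* p :+ a :* q :- r)
             refl (e 1) (e 2) (e 3) p₂ p₃ p₄ ⟩
      e 3 * e 1 - e 2 * p₂ + e 1 * p₃ - p₄        ∎

    step : (Fin m → Carrier) → Fin m → Carrier
    step f j = x j * (∑ f - f j)

    step-cong : ∀ {f g} → (∀ j → f j ≈ g j) → ∀ j → step f j ≈ step g j
    step-cong p j = *-congˡ (+-cong (∑-cong p) (-‿cong (p j)))

    ∑-step : ∀ f → ∑ (step f) ≈ e 1 * ∑ f - ∑ (λ j → x j * f j)
    ∑-step f = begin
      ∑ (step f)
        ≈⟨ ∑-cong (λ j → solve 3 (λ x F y → x :* (F :- y) := F :* x :+ (:- con (ℕ⇒ℚ 1)) :* (x :* y))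
             refl (x j) (∑ f) (f j)) ⟩
      ∑ (λ j → ∑ f * x j + - num 1 * (x j * f j))
        ≈⟨ ∑-snoc (- num 1) (λ j → x j * f j) (∑-* (∑ f) x) ⟩
      ∑ f * ∑ x + - num 1 * ∑ (λ j → x j * f j)
        ≈⟨ +-congʳ (*-congˡ newton₁) ⟩
      ∑ f * e 1 + - num 1 * ∑ (λ j → x j * f j)
        ≈⟨ solve 3 (λ F a q → F :* a :+ (:- con (ℕ⇒ℚ 1)) :* q := a :* F :- q)
             refl (∑ f) (e 1) (∑ (λ j → x j * f j)) ⟩
      e 1 * ∑ f - ∑ (λ j → x j * f j) ∎

    ∑-step² : ∀ f → ∑ (λ j → ē 2 j * f j) ≈ ∑ (step (step f)) - e 2 * ∑ f
    ∑-step² f = begin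
      ∑ (λ j → ē 2 j * f j)
        ≈⟨ ∑-cong (λ j → trans (*-congʳ (ē₂ j)) (solve 4 (λ a b x y →
             (b :- a :* x :+ x :* x) :* y := b :* y :+ (:- a) :* (x :* y) :+ con (ℕ⇒ℚ 1) :* (x :* (x :* y)))
             refl (e 1) (e 2) (x j) (f j))) ⟩
      ∑ (λ j → e 2 * f j + - e 1 * (x j * f j) + num 1 * (x j * (x j * f j)))
        ≈⟨ ∑-snoc (num 1) (λ j → x j * (x j * f j)) (∑-snoc (- e 1) (λ j → x j * f j) (∑-* (e 2) f)) ⟩
      e 2 * F + - e 1 * F₁ + num 1 * F₂
        ≈⟨ solve 5 (λ a b F F₁ F₂ → b :* F :+ (:- a) :* F₁ :+ con (ℕ⇒ℚ 1) :* F₂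
                 := (con (ℕ⇒ℚ 2) :* b) :* F :- a :* F₁ :+ F₂ :- b :* F)
             refl (e 1) (e 2) F F₁ F₂ ⟩
      num 2 * e 2 * F - e 1 * F₁ + F₂ - e 2 * F
        ≈⟨ +-congʳ (+-congʳ (+-congʳ (*-congʳ newton₂))) ⟩
      (e 1 * e 1 - p₂) * F - e 1 * F₁ + F₂ - e 2 * F
        ≈⟨ solve 6 (λ a b p F F₁ F₂ → (a :* a :- p) :* F :- a :* F₁ :+ F₂ :- b :* F
                 := a :* (a :* F :- F₁) :- (F :* p :+ (:- con (ℕ⇒ℚ 1)) :* F₂) :- b :* F)
             refl (e 1) (e 2) p₂ F F₁ F₂ ⟩
      e 1 * (e 1 * F - F₁) - (F * p₂ + - num 1 * F₂) - e 2 * F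
        ≈⟨ +-congʳ (+-cong (*-congˡ (∑-step f)) (-‿cong x∙step)) ⟨
      e 1 * ∑ (step f) - ∑ (λ j → x j * step f j) - e 2 * F
        ≈⟨ +-congʳ (∑-step (step f)) ⟨
      ∑ (step (step f)) - e 2 * F ∎
      where
      F F₁ F₂ : Carrier
      F  = ∑ f
      F₁ = ∑ (λ j → x j * f j)
      F₂ = ∑ (λ j → x j * (x j * f j))
      x∙step : ∑ (λ j → x j * step f j) ≈ F * p₂ + - num 1 * F₂
      x∙step = trans (∑-cong (λ j → solve 3 (λ x F y → x :* (x :* (F :- y))
                                       := F :* (x :* x) :+ (:- con (ℕ⇒ℚ 1)) :* (x :* (x :* y)))
                               refl (x j) F (f j)))
                     (∑-snoc (- num 1) (λ j → x j * (x j * f j)) (∑-* F (λ j → x j * x j)))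

    walk : ℕ → Fin m → Carrier
    walk zero    = x
    walk (suc n) = step (walk n)

    s : ℕ → Carrier
    s zero    = 1#
    s (suc n) = ∑ (walk n)

    walk₂ : ∀ j → x j * ē 2 j ≈ walk 2 j - e 2 * walk 0 j
    walk₂ j = begin
      x j * ē 2 j
        ≈⟨ *-congˡ (ē₂ j) ⟩
      x j * (e 2 - e 1 * x j + x j * x j)
        ≈⟨ solve 3 (λ a b x → x :* (b :- a :* x :+ x :* x)
                 := x :* (con (ℕ⇒ℚ 2) :* b :- x :* (a :- x)) :- b :* x) refl (e 1) (e 2) (x j) ⟩
      x j * (num 2 * e 2 - x j * (e 1 - x j)) - e 2 * x j
        ≈⟨ +-congʳ (*-congˡ (+-cong (trans (trans (∑-step x) (+-congʳ (*-congˡ newton₁))) (sym newton₂))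
             (-‿cong (*-congˡ (+-congʳ newton₁))))) ⟨
      walk 2 j - e 2 * walk 0 j ∎

    twinWalk : ℕ → Fin m → Carrier
    twinWalk k j = walk (2 ℕ.+ k) j - e 2 * walk k j

    ∑-twinWalk : ∀ k → ∑ (twinWalk k) ≈ s (3 ℕ.+ k) - e 2 * s (1 ℕ.+ k)
    ∑-twinWalk k = trans (∑-distrib-- (walk (2 ℕ.+ k)) (λ j → e 2 * walk k j))
                         (+-congˡ (-‿cong (∑-* (e 2) (walk k))))

    step-twinWalk : ∀ k j → step (twinWalk k) j ≈ twinWalk (suc k) j
    step-twinWalk k j = trans (*-congˡ (+-congʳ (∑-twinWalk k)))
      (solve 6 (λ x b S S′ w w′ → x :* (S :- b :* S′ :- (w :- b :* w′)) := x :* (S :- w) :- b :* (x :* (S′ :- w′)))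
        refl (x j) (e 2) (s (3 ℕ.+ k)) (s (1 ℕ.+ k)) (walk (2 ℕ.+ k) j) (walk k j))

    -- The index is shifted: A k is a quarter of the chromatic symmetric function of P_{k+3,v,w}.
    A : ℕ → Carrier
    A k = s (5 ℕ.+ k) - num 2 * e 2 * s (3 ℕ.+ k) + e 2 * e 2 * s (1 ℕ.+ k)

    ∑-ē₂-twinWalk : ∀ k → ∑ (λ j → ē 2 j * twinWalk k j) ≈ A k
    ∑-ē₂-twinWalk k = begin
      ∑ (λ j → ē 2 j * twinWalk k j)
        ≈⟨ ∑-step² (twinWalk k) ⟩
      ∑ (step (step (twinWalk k))) - e 2 * ∑ (twinWalk k)
        ≈⟨ +-congʳ (∑-cong (λ j → trans (step-cong (step-twinWalk k) j) (step-twinWalk (suc k) j))) ⟩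
      ∑ (twinWalk (2 ℕ.+ k)) - e 2 * ∑ (twinWalk k)
        ≈⟨ +-cong (∑-twinWalk (2 ℕ.+ k)) (-‿cong (*-congˡ (∑-twinWalk k))) ⟩
      s (5 ℕ.+ k) - e 2 * s (3 ℕ.+ k) - e 2 * (s (3 ℕ.+ k) - e 2 * s (1 ℕ.+ k))
        ≈⟨ solve 4 (λ b S₅ S₃ S₁ → S₅ :- b :* S₃ :- b :* (S₃ :- b :* S₁)
                 := S₅ :- con (ℕ⇒ℚ 2) :* b :* S₃ :+ b :* b :* S₁)
             refl (e 2) (s (5 ℕ.+ k)) (s (3 ℕ.+ k)) (s (1 ℕ.+ k)) ⟩
      A k ∎

    -- With E(z) = Σ eₖ zᵏ and Eᵢ(z) the same series without the variable xᵢ, the two rules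
    -- E = (1 + xᵢ z) Eᵢ and (1 + xᵢ z) Wᵢ = xᵢ z S combine to E Wᵢ = xᵢ z Eᵢ S.
    ended : Fin m → PowerSeries
    ended i zero    = 0#
    ended i (suc n) = walk n i

    ended-shift : ∀ i → ended i ≋ shift (λ n → x i * (s n - ended i n))
    ended-shift i zero          = refl
    ended-shift i (suc zero)    = sym (trans (*-congˡ (trans (+-congˡ -0#≈0#) (+-identityʳ _))) (*-identityʳ _))
      where open import Algebra.Properties.Ring ring using (-0#≈0#)
    ended-shift i (suc (suc n)) = refl

    e-shift : ∀ i → e ≋ λ n → ē n i + shift (λ n → x i * ē n i) n
    e-shift i zero    = trans e-zero (trans (sym (ē-zero i)) (sym (+-identityʳ _)))
    e-shift i (suc n) = e-split n i

    conv-e-ended : ∀ i k → conv e (ended i) (suc k) ≈ x i * conv (λ n → ē n i) s k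
    conv-e-ended i k = begin
      conv e w (suc k)
        ≈⟨ conv-cong {g = w} (e-shift i) (λ _ → refl) (suc k) ⟩
      conv (λ n → E n + shift (λ n → x i * E n) n) w (suc k)
        ≈⟨ conv-distribʳ w E (shift (λ n → x i * E n)) (suc k) ⟩
      conv E w (suc k) + conv (shift (λ n → x i * E n)) w (suc k)
        ≈⟨ +-cong (conv-Ew k) (trans (conv-shiftˡ (λ n → x i * E n) w (suc k)) (conv-*ˡ (x i) E w k)) ⟩
      x i * (conv E s k - conv E w k) + x i * conv E w k
        ≈⟨ solve 3 (λ x a b → x :* (a :- b) :+ x :* b := x :* a) refl (x i) (conv E s k) (conv E w k) ⟩
      x i * conv E s k ∎
      where
      w E : PowerSeries
      w = ended i
      E n = ē n i
      conv-Ew : ∀ k → conv E w (suc k) ≈ x i * (conv E s k - conv E w k)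
      conv-Ew k = begin
        conv E w (suc k)
          ≈⟨ conv-cong {f = E} (λ _ → refl) (ended-shift i) (suc k) ⟩
        conv E (shift (λ n → x i * (s n - w n))) (suc k)
          ≈⟨ conv-comm E (shift (λ n → x i * (s n - w n))) (suc k) ⟩
        conv (shift (λ n → x i * (s n - w n))) E (suc k)
          ≈⟨ conv-shiftˡ (λ n → x i * (s n - w n)) E (suc k) ⟩
        conv (λ n → x i * (s n - w n)) E k
          ≈⟨ conv-*ˡ (x i) (λ n → s n - w n) E k ⟩
        x i * conv (λ n → s n - w n) E k
          ≈⟨ *-congˡ (trans (P.*-distribʳ-- E s w k) (+-cong (conv-comm s E k) (-‿cong (conv-comm w E k)))) ⟩
        x i * (conv E s k - conv E w k) ∎
        where
        module P where
          open import Algebra.Properties.Ring (CommutativeRing.ring powerSeriesRing) using (-‿distribˡ-*)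
          *-distribʳ-- : ∀ h f g → conv (λ n → f n - g n) h ≋ λ n → conv f h n - conv g h n
          *-distribʳ-- h f g n = trans (conv-distribʳ h f (λ n → - g n) n) (+-congˡ (sym (-‿distribˡ-* g h n)))

    s-newton : ∀ k → conv e (s ∘ suc) k ≈ conv (λ n → num (suc n) * e (suc n)) s k
    s-newton k = begin
      conv e (s ∘ suc) k
        ≈⟨ trans (+-congˡ (trans (*-congˡ (∑-zero m)) (zeroʳ _))) (+-identityʳ _) ⟨
      conv e (s ∘ suc) k + e (suc k) * ∑ {m} (λ i → 0#)
        ≈⟨ conv-last e (λ n → ∑ (λ i → ended i n)) k ⟨
      conv e (λ n → ∑ (λ i → ended i n)) (suc k)
        ≈⟨ conv-∑ʳ e ended (suc k) ⟨
      ∑ (λ i → conv e (ended i) (suc k))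
        ≈⟨ ∑-cong (λ i → trans (conv-e-ended i k) (sym (conv-*ˡ (x i) (λ n → ē n i) s k))) ⟩
      ∑ (λ i → conv (λ n → x i * ē n i) s k)
        ≈⟨ conv-∑ˡ (λ i n → x i * ē n i) s k ⟩
      conv (λ n → ∑ (λ i → x i * ē n i)) s k
        ≈⟨ conv-cong {g = s} e-sum (λ _ → refl) k ⟩
      conv (λ n → num (suc n) * e (suc n)) s k ∎

    s-recurrence : ∀ k → s (2 ℕ.+ k) ≈ conv (λ j → num j * e (suc j)) (s ∘ suc) k + num (2 ℕ.+ k) * e (2 ℕ.+ k)
    s-recurrence k = begin
      s (2 ℕ.+ k)
        ≈⟨ solve 2 (λ a b → a := a :+ b :- b) refl (s (2 ℕ.+ k)) C ⟩
      s (2 ℕ.+ k) + C - C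
        ≈⟨ +-congʳ (+-congʳ (trans (*-congʳ e-zero) (*-identityˡ _))) ⟨
      conv e (s ∘ suc) (suc k) - C
        ≈⟨ +-congʳ (trans (s-newton (suc k)) (conv-last (λ n → num (suc n) * e (suc n)) s k)) ⟩
      conv (λ n → num (suc n) * e (suc n)) (s ∘ suc) k + D * 1# - C
        ≈⟨ +-congʳ (+-cong (trans (conv-cong {g = s ∘ suc} num-suc (λ _ → refl) k)
             (conv-distribʳ (s ∘ suc) (e ∘ suc) (λ n → num n * e (suc n)) k)) (*-identityʳ D)) ⟩
      C + C′ + D - C
        ≈⟨ solve 3 (λ a b c → a :+ b :+ c :- a := b :+ c) refl C C′ D ⟩
      C′ + D ∎
      where
      C C′ D : Carrier
      C  = conv (e ∘ suc) (s ∘ suc) k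
      C′ = conv (λ j → num j * e (suc j)) (s ∘ suc) k
      D  = num (2 ℕ.+ k) * e (2 ℕ.+ k)
      num-suc : ∀ n → num (suc n) * e (suc n) ≈ e (suc n) + num n * e (suc n)
      num-suc n = trans (*-congʳ (num-+ 1 n))
        (solve 2 (λ a b → (con (ℕ⇒ℚ 1) :+ a) :* b := b :+ a :* b) refl (num n) (e (suc n)))

    c : ℕ → Carrier
    c i = num (2 ℕ.+ i) * e (3 ℕ.+ i)

    s-rec : ∀ k → s (4 ℕ.+ k) ≈ e 2 * s (2 ℕ.+ k) + conv c (s ∘ suc) k + num (4 ℕ.+ k) * e (4 ℕ.+ k)
    s-rec k = trans (s-recurrence (2 ℕ.+ k))
      (solve 6 (λ a S b S′ C D → con (ℕ⇒ℚ 0) :* a :* S :+ (con (ℕ⇒ℚ 1) :* b :* S′ :+ C) :+ D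
                              := b :* S′ :+ C :+ D)
        refl (e 1) (s (3 ℕ.+ k)) (e 2) (s (2 ℕ.+ k)) (conv c (s ∘ suc) k) (num (4 ℕ.+ k) * e (4 ℕ.+ k)))

    s₁ : s 1 ≈ e 1
    s₁ = newton₁

    s₂ : s 2 ≈ num 2 * e 2
    s₂ = trans (s-recurrence 0)
      (solve 3 (λ a b S → con (ℕ⇒ℚ 0) :* a :* S :+ con (ℕ⇒ℚ 2) :* b := con (ℕ⇒ℚ 2) :* b)
        refl (e 1) (e 2) (s 1))

    s₃ : s 3 ≈ num 3 * e 3 + e 2 * e 1
    s₃ = trans (s-recurrence 1) (trans (+-congʳ (+-congˡ (*-congˡ s₁)))
      (solve 4 (λ a b c S → con (ℕ⇒ℚ 0) :* a :* S :+ con (ℕ⇒ℚ 1) :* b :* a :+ con (ℕ⇒ℚ 3) :* c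
                         := con (ℕ⇒ℚ 3) :* c :+ b :* a)
        refl (e 1) (e 2) (e 3) (s 2)))

    s₄ : s 4 ≈ num 4 * e 4 + num 2 * e 3 * e 1 + num 2 * e 2 * e 2
    s₄ = trans (s-rec 0) (trans (+-congʳ (+-cong (*-congˡ s₂) (*-congˡ s₁)))
      (solve 4 (λ a b c d → b :* (con (ℕ⇒ℚ 2) :* b) :+ con (ℕ⇒ℚ 2) :* c :* a :+ con (ℕ⇒ℚ 4) :* d
                         := con (ℕ⇒ℚ 4) :* d :+ con (ℕ⇒ℚ 2) :* c :* a :+ con (ℕ⇒ℚ 2) :* b :* b)
        refl (e 1) (e 2) (e 3) (e 4)))

    conv-tails : ∀ k → conv c (s ∘ suc) (2 ℕ.+ k) ≈ conv c (s ∘ (3 ℕ.+_)) k + c (1 ℕ.+ k) * s 2 + c (2 ℕ.+ k) * s 1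
    conv-tails k = trans (conv-last c (s ∘ suc) (1 ℕ.+ k)) (+-congʳ (conv-last c (s ∘ (2 ℕ.+_)) k))

    conv-tails₄ : ∀ k → conv c (s ∘ suc) (4 ℕ.+ k)
                      ≈ conv c (s ∘ (5 ℕ.+_)) k + c (1 ℕ.+ k) * s 4 + c (2 ℕ.+ k) * s 3
                        + c (3 ℕ.+ k) * s 2 + c (4 ℕ.+ k) * s 1
    conv-tails₄ k = trans (conv-tails (2 ℕ.+ k)) (+-congʳ (+-congʳ
      (trans (conv-last c (s ∘ (3 ℕ.+_)) (1 ℕ.+ k)) (+-congʳ (conv-last c (s ∘ (4 ℕ.+_)) k)))))

    conv-A : ∀ k → conv c A k ≈ conv c (s ∘ (5 ℕ.+_)) k - num 2 * e 2 * conv c (s ∘ (3 ℕ.+_)) k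
                                + e 2 * e 2 * conv c (s ∘ suc) k
    conv-A k = begin
      conv c A k
        ≈⟨ conv-distribˡ c (λ i → s (5 ℕ.+ i) - num 2 * e 2 * s (3 ℕ.+ i)) (λ i → e 2 * e 2 * s (1 ℕ.+ i)) k ⟩
      conv c (λ i → s (5 ℕ.+ i) - num 2 * e 2 * s (3 ℕ.+ i)) k + conv c (λ i → e 2 * e 2 * s (1 ℕ.+ i)) k
        ≈⟨ +-cong (conv-distribˡ c (s ∘ (5 ℕ.+_)) (λ i → - (num 2 * e 2 * s (3 ℕ.+ i))) k)
                  (conv-*ʳ (e 2 * e 2) c (s ∘ suc) k) ⟩
      conv c (s ∘ (5 ℕ.+_)) k + conv c (λ i → - (num 2 * e 2 * s (3 ℕ.+ i))) k + e 2 * e 2 * conv c (s ∘ suc) k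
        ≈⟨ +-congʳ (+-congˡ (trans (sym (-‿distribʳ-* c (λ i → num 2 * e 2 * s (3 ℕ.+ i)) k))
             (-‿cong (conv-*ʳ (num 2 * e 2) c (s ∘ (3 ℕ.+_)) k)))) ⟩
      conv c (s ∘ (5 ℕ.+_)) k - num 2 * e 2 * conv c (s ∘ (3 ℕ.+_)) k + e 2 * e 2 * conv c (s ∘ suc) k ∎
      where open import Algebra.Properties.Ring (CommutativeRing.ring powerSeriesRing) using (-‿distribʳ-*)

    -- Lets a hypothesis u ≈ v enter an identity through a multiple of u - v, so that the solver can treat u as a variable.
    drop : ∀ {u v} → u ≈ v → ∀ {l r} a → l ≈ r + a * (u - v) → l ≈ r
    drop {u} {v} u≈v {l} {r} a h = begin
      l               ≈⟨ h ⟩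
      r + a * (u - v) ≈⟨ +-congˡ (*-congˡ (+-congʳ u≈v)) ⟩
      r + a * (v - v) ≈⟨ solve 3 (λ r a v → r :+ a :* (v :- v) := r) refl r a v ⟩
      r               ∎

    c-num : ∀ j k → c (j ℕ.+ k) ≈ (num (2 ℕ.+ j) + num k) * e (3 ℕ.+ (j ℕ.+ k))
    c-num j k = *-congʳ (num-+ (2 ℕ.+ j) k)

    s-rec₄ : ∀ k → s (4 ℕ.+ k) ≈ e 2 * s (2 ℕ.+ k) + conv c (s ∘ suc) k + (num 4 + num k) * e (4 ℕ.+ k)
    s-rec₄ k = trans (s-rec k) (+-congˡ (*-congʳ (num-+ 4 k)))

    s-rec₆ : ∀ k → s (6 ℕ.+ k) ≈ e 2 * s (4 ℕ.+ k)
      + (conv c (s ∘ (3 ℕ.+_)) k + (num 3 + num k) * e (4 ℕ.+ k) * (num 2 * e 2) + (num 4 + num k) * e (5 ℕ.+ k) * e 1)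
      + (num 6 + num k) * e (6 ℕ.+ k)
    s-rec₆ k = trans (s-rec (2 ℕ.+ k)) (+-cong (+-congˡ (trans (conv-tails k)
      (+-cong (+-congˡ (*-cong (c-num 1 k) s₂)) (*-cong (c-num 2 k) s₁)))) (*-congʳ (num-+ 6 k)))

    s-rec₈ : ∀ k → s (8 ℕ.+ k) ≈ e 2 * s (6 ℕ.+ k)
      + (conv c (s ∘ (5 ℕ.+_)) k
         + (num 3 + num k) * e (4 ℕ.+ k) * (num 4 * e 4 + num 2 * e 3 * e 1 + num 2 * e 2 * e 2)
         + (num 4 + num k) * e (5 ℕ.+ k) * (num 3 * e 3 + e 2 * e 1)
         + (num 5 + num k) * e (6 ℕ.+ k) * (num 2 * e 2)
         + (num 6 + num k) * e (7 ℕ.+ k) * e 1)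
      + (num 8 + num k) * e (8 ℕ.+ k)
    s-rec₈ k = trans (s-rec (4 ℕ.+ k)) (+-cong (+-congˡ (trans (conv-tails₄ k)
      (+-cong (+-cong (+-cong (+-congˡ (*-cong (c-num 1 k) s₄)) (*-cong (c-num 2 k) s₃))
        (*-cong (c-num 3 k) s₂)) (*-cong (c-num 4 k) s₁)))) (*-congʳ (num-+ 8 k)))

    A-recurrence : ∀ k → A (3 ℕ.+ k) ≈ conv c A k
      + (num 8 + num k) * e (8 ℕ.+ k)
      + (num 6 + num k) * e (7 ℕ.+ k) * e 1
      + num 3 * (num 4 + num k) * e (5 ℕ.+ k) * e 3
      + num 2 * (num 3 + num k) * e (4 ℕ.+ k) * e 3 * e 1
      + num 4 * (num 3 + num k) * e (4 ℕ.+ k) * e 4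
      + e 2 * (A (1 ℕ.+ k) - num 2 * e (6 ℕ.+ k) - (num 2 + num k) * e (4 ℕ.+ k) * e 2
               - (num 4 + num k) * e (5 ℕ.+ k) * e 1)
    A-recurrence k =
      drop (s-rec₈ k) (num 1) (drop (s-rec₆ k) (- (num 2 * e 2)) (drop (s-rec₄ k) (e 2 * e 2) (drop (conv-A k) (- num 1)
      (solve 18 (λ κ a b c d E₄ E₅ E₆ E₇ E₈ S₂ S₄ S₆ S₈ C₁ C₃ C₅ CA →
         S₈ :- n 2 :* b :* S₆ :+ b :* b :* S₄
         := CA
            :+ (n 8 :+ κ) :* E₈ :+ (n 6 :+ κ) :* E₇ :* a :+ n 3 :* (n 4 :+ κ) :* E₅ :* c
            :+ n 2 :* (n 3 :+ κ) :* E₄ :* c :* a :+ n 4 :* (n 3 :+ κ) :* E₄ :* d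
            :+ b :* (S₆ :- n 2 :* b :* S₄ :+ b :* b :* S₂ :- n 2 :* E₆ :- (n 2 :+ κ) :* E₄ :* b :- (n 4 :+ κ) :* E₅ :* a)
            :+ n 1 :* (S₈ :- (b :* S₆ :+ (C₅ :+ (n 3 :+ κ) :* E₄ :* (n 4 :* d :+ n 2 :* c :* a :+ n 2 :* b :* b)
                 :+ (n 4 :+ κ) :* E₅ :* (n 3 :* c :+ b :* a) :+ (n 5 :+ κ) :* E₆ :* (n 2 :* b)
                 :+ (n 6 :+ κ) :* E₇ :* a) :+ (n 8 :+ κ) :* E₈))
            :+ (:- (n 2 :* b)) :* (S₆ :- (b :* S₄ :+ (C₃ :+ (n 3 :+ κ) :* E₄ :* (n 2 :* b) :+ (n 4 :+ κ) :* E₅ :* a)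
                 :+ (n 6 :+ κ) :* E₆))
            :+ (b :* b) :* (S₄ :- (b :* S₂ :+ C₁ :+ (n 4 :+ κ) :* E₄))
            :+ (:- n 1) :* (CA :- (C₅ :- n 2 :* b :* C₃ :+ b :* b :* C₁)))
         refl (num k) (e 1) (e 2) (e 3) (e 4) (e (4 ℕ.+ k)) (e (5 ℕ.+ k)) (e (6 ℕ.+ k)) (e (7 ℕ.+ k)) (e (8 ℕ.+ k))
         (s (2 ℕ.+ k)) (s (4 ℕ.+ k)) (s (6 ℕ.+ k)) (s (8 ℕ.+ k))
         (conv c (s ∘ suc) k) (conv c (s ∘ (3 ℕ.+_)) k) (conv c (s ∘ (5 ℕ.+_)) k) (conv c A k)))))

    s₅ : s 5 ≈ num 5 * e 5 + num 3 * e 4 * e 1 + num 7 * e 3 * e 2 + e 2 * e 2 * e 1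
    s₅ = trans (s-rec 1) (trans (+-congʳ (+-cong (*-congˡ s₃) (+-cong (*-congˡ s₂) (*-congˡ s₁))))
      (solve 5 (λ a b c d f → b :* (n 3 :* c :+ b :* a) :+ (n 2 :* c :* (n 2 :* b) :+ n 3 :* d :* a) :+ n 5 :* f
                           := n 5 :* f :+ n 3 :* d :* a :+ n 7 :* c :* b :+ b :* b :* a)
        refl (e 1) (e 2) (e 3) (e 4) (e 5)))

    A₀ : A 0 ≈ e 3 * e 2 + num 3 * e 4 * e 1 + num 5 * e 5
    A₀ = trans (+-cong (+-cong s₅ (-‿cong (*-congˡ s₃))) (*-congˡ s₁))
      (solve 5 (λ a b c d f → n 5 :* f :+ n 3 :* d :* a :+ n 7 :* c :* b :+ b :* b :* a
                              :- n 2 :* b :* (n 3 :* c :+ b :* a) :+ b :* b :* a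
                           := c :* b :+ n 3 :* d :* a :+ n 5 :* f)
        refl (e 1) (e 2) (e 3) (e 4) (e 5))

    A₁ : A 1 ≈ num 6 * e 3 * e 3 + num 2 * e 4 * e 2 + num 4 * e 5 * e 1 + num 6 * e 6
    A₁ = trans (+-cong (+-cong (trans (s-rec 2) (+-congʳ (+-congˡ
             (+-cong (*-congˡ s₃) (+-cong (*-congˡ s₂) (*-congˡ s₁)))))) (-‿cong refl)) (*-congˡ s₂))
      (drop s₄ (- e 2)
      (solve 7 (λ a b c d f g S₄ → b :* S₄ :+ (n 2 :* c :* (n 3 :* c :+ b :* a) :+ (n 3 :* d :* (n 2 :* b) :+ n 4 :* f :* a))
                                   :+ n 6 :* g :- n 2 :* b :* S₄ :+ b :* b :* (n 2 :* b)
                                := n 6 :* c :* c :+ n 2 :* d :* b :+ n 4 :* f :* a :+ n 6 :* g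
                                   :+ (:- b) :* (S₄ :- (n 4 :* d :+ n 2 :* c :* a :+ n 2 :* b :* b)))
        refl (e 1) (e 2) (e 3) (e 4) (e 5) (e 6) (s 4)))

    A₂ : A 2 ≈ num 4 * e 3 * e 3 * e 1 + num 17 * e 4 * e 3 + num 3 * e 5 * e 2 + num 5 * e 6 * e 1 + num 7 * e 7
    A₂ = trans (+-cong (+-cong (trans (s-rec 3) (+-congʳ (+-congˡ
             (+-cong (*-congˡ s₄) (+-cong (*-congˡ s₃) (+-cong (*-congˡ s₂) (*-congˡ s₁))))))) (-‿cong refl)) (*-congˡ s₃))
      (drop s₅ (- e 2)
      (solve 8 (λ a b c d f g h S₅ →
           b :* S₅ :+ (n 2 :* c :* (n 4 :* d :+ n 2 :* c :* a :+ n 2 :* b :* b)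
                       :+ (n 3 :* d :* (n 3 :* c :+ b :* a) :+ (n 4 :* f :* (n 2 :* b) :+ n 5 :* g :* a)))
             :+ n 7 :* h :- n 2 :* b :* S₅ :+ b :* b :* (n 3 :* c :+ b :* a)
           := n 4 :* c :* c :* a :+ n 17 :* d :* c :+ n 3 :* f :* b :+ n 5 :* g :* a :+ n 7 :* h
              :+ (:- b) :* (S₅ :- (n 5 :* f :+ n 3 :* d :* a :+ n 7 :* c :* b :+ b :* b :* a)))
        refl (e 1) (e 2) (e 3) (e 4) (e 5) (e 6) (e 7) (s 5)))

    4A₀ : num 4 * A 0 ≈ num 4 * e 3 * e 2 + num 12 * e 4 * e 1 + num 20 * e 5
    4A₀ = trans (*-congˡ A₀)
      (solve 5 (λ a b c d f → n 4 :* (c :* b :+ n 3 :* d :* a :+ n 5 :* f)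
                           := n 4 :* c :* b :+ n 12 :* d :* a :+ n 20 :* f)
        refl (e 1) (e 2) (e 3) (e 4) (e 5))

    4A₁ : num 4 * A 1 ≈ num 24 * e 3 * e 3 + num 8 * e 4 * e 2 + num 16 * e 5 * e 1 + num 24 * e 6
    4A₁ = trans (*-congˡ A₁)
      (solve 6 (λ a b c d f g → n 4 :* (n 6 :* c :* c :+ n 2 :* d :* b :+ n 4 :* f :* a :+ n 6 :* g)
                             := n 24 :* c :* c :+ n 8 :* d :* b :+ n 16 :* f :* a :+ n 24 :* g)
        refl (e 1) (e 2) (e 3) (e 4) (e 5) (e 6))

    4A₂ : num 4 * A 2 ≈ num 16 * e 3 * e 3 * e 1 + num 68 * e 4 * e 3 + num 12 * e 5 * e 2 + num 20 * e 6 * e 1 + num 28 * e 7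
    4A₂ = trans (*-congˡ A₂)
      (solve 7 (λ a b c d f g h →
           n 4 :* (n 4 :* c :* c :* a :+ n 17 :* d :* c :+ n 3 :* f :* b :+ n 5 :* g :* a :+ n 7 :* h)
           := n 16 :* c :* c :* a :+ n 68 :* d :* c :+ n 12 :* f :* b :+ n 20 :* g :* a :+ n 28 :* h)
        refl (e 1) (e 2) (e 3) (e 4) (e 5) (e 6) (e 7))

    -- What remains of A k once the terms that feed the negative terms of the recurrence are removed.
    C : ℕ → Carrier
    C k = A k - (num 5 + num k) * e (5 ℕ.+ k) - (num 1 + num k) * e (3 ℕ.+ k) * e 2 - (num 3 + num k) * e (4 ℕ.+ k) * e 1

    C₀ : C 0 ≈ 0#
    C₀ = drop A₀ (num 1) (trans (solve 6 (λ a b c d f A →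
        A :- (n 5 :+ n 0) :* f :- (n 1 :+ n 0) :* c :* b :- (n 3 :+ n 0) :* d :* a
        := n 0 :+ n 1 :* (A :- (c :* b :+ n 3 :* d :* a :+ n 5 :* f)))
      refl (e 1) (e 2) (e 3) (e 4) (e 5) (A 0)) (+-congʳ 0-homo))

    C₁ : C 1 ≈ num 6 * e 3 * e 3
    C₁ = drop A₁ (num 1) (solve 7 (λ a b c d f g A →
        A :- (n 5 :+ n 1) :* g :- (n 1 :+ n 1) :* d :* b :- (n 3 :+ n 1) :* f :* a
        := n 6 :* c :* c :+ n 1 :* (A :- (n 6 :* c :* c :+ n 2 :* d :* b :+ n 4 :* f :* a :+ n 6 :* g)))
      refl (e 1) (e 2) (e 3) (e 4) (e 5) (e 6) (A 1))

    C₂ : C 2 ≈ num 4 * e 3 * e 3 * e 1 + num 17 * e 4 * e 3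
    C₂ = drop A₂ (num 1) (solve 8 (λ a b c d f g h A →
        A :- (n 5 :+ n 2) :* h :- (n 1 :+ n 2) :* f :* b :- (n 3 :+ n 2) :* g :* a
        := n 4 :* c :* c :* a :+ n 17 :* d :* c
           :+ n 1 :* (A :- (n 4 :* c :* c :* a :+ n 17 :* d :* c :+ n 3 :* f :* b :+ n 5 :* g :* a :+ n 7 :* h)))
      refl (e 1) (e 2) (e 3) (e 4) (e 5) (e 6) (e 7) (A 2))

    C-recurrence : ∀ k → C (3 ℕ.+ k) ≈ conv c A k
      + num 3 * (num 4 + num k) * e (5 ℕ.+ k) * e 3
      + num 2 * (num 3 + num k) * e (4 ℕ.+ k) * e 3 * e 1
      + num 4 * (num 3 + num k) * e (4 ℕ.+ k) * e 4
      + e 2 * C (1 ℕ.+ k)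
    C-recurrence k = begin
      C (3 ℕ.+ k)
        ≈⟨ +-cong (+-cong (+-congˡ (-‿cong (*-congʳ (+-congˡ (num-+ 3 k)))))
             (-‿cong (*-congʳ (*-congʳ (+-congˡ (num-+ 3 k)))))) (-‿cong (*-congʳ (*-congʳ (+-congˡ (num-+ 3 k))))) ⟩
      A (3 ℕ.+ k) - (num 5 + (num 3 + num k)) * e (8 ℕ.+ k) - (num 1 + (num 3 + num k)) * e (6 ℕ.+ k) * e 2
        - (num 3 + (num 3 + num k)) * e (7 ℕ.+ k) * e 1
        ≈⟨ drop (A-recurrence k) (num 1) (solve 13 (λ κ a b c d E₄ E₅ E₆ E₇ E₈ A₃ A₁ CA →
             A₃ :- (n 5 :+ (n 3 :+ κ)) :* E₈ :- (n 1 :+ (n 3 :+ κ)) :* E₆ :* b :- (n 3 :+ (n 3 :+ κ)) :* E₇ :* a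
             := CA :+ n 3 :* (n 4 :+ κ) :* E₅ :* c :+ n 2 :* (n 3 :+ κ) :* E₄ :* c :* a :+ n 4 :* (n 3 :+ κ) :* E₄ :* d
                :+ b :* (A₁ :- (n 5 :+ (n 1 :+ κ)) :* E₆ :- (n 1 :+ (n 1 :+ κ)) :* E₄ :* b :- (n 3 :+ (n 1 :+ κ)) :* E₅ :* a)
                :+ n 1 :* (A₃ :- (CA
                    :+ (n 8 :+ κ) :* E₈ :+ (n 6 :+ κ) :* E₇ :* a :+ n 3 :* (n 4 :+ κ) :* E₅ :* c
                    :+ n 2 :* (n 3 :+ κ) :* E₄ :* c :* a :+ n 4 :* (n 3 :+ κ) :* E₄ :* d
                    :+ b :* (A₁ :- n 2 :* E₆ :- (n 2 :+ κ) :* E₄ :* b :- (n 4 :+ κ) :* E₅ :* a))))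
             refl (num k) (e 1) (e 2) (e 3) (e 4) (e (4 ℕ.+ k)) (e (5 ℕ.+ k)) (e (6 ℕ.+ k)) (e (7 ℕ.+ k)) (e (8 ℕ.+ k))
             (A (3 ℕ.+ k)) (A (1 ℕ.+ k)) (conv c A k)) ⟩
      conv c A k + num 3 * (num 4 + num k) * e (5 ℕ.+ k) * e 3 + num 2 * (num 3 + num k) * e (4 ℕ.+ k) * e 3 * e 1
        + num 4 * (num 3 + num k) * e (4 ℕ.+ k) * e 4
        + e 2 * (A (1 ℕ.+ k) - (num 5 + (num 1 + num k)) * e (6 ℕ.+ k) - (num 1 + (num 1 + num k)) * e (4 ℕ.+ k) * e 2
                 - (num 3 + (num 1 + num k)) * e (5 ℕ.+ k) * e 1)
        ≈⟨ +-congˡ (*-congˡ (+-cong (+-cong (+-congˡ (-‿cong (*-congʳ (+-congˡ (num-+ 1 k)))))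
             (-‿cong (*-congʳ (*-congʳ (+-congˡ (num-+ 1 k)))))) (-‿cong (*-congʳ (*-congʳ (+-congˡ (num-+ 1 k))))))) ⟨
      conv c A k + num 3 * (num 4 + num k) * e (5 ℕ.+ k) * e 3 + num 2 * (num 3 + num k) * e (4 ℕ.+ k) * e 3 * e 1
        + num 4 * (num 3 + num k) * e (4 ℕ.+ k) * e 4 + e 2 * C (1 ℕ.+ k) ∎

    A-split : ∀ k → A k ≈ C k + ((num 5 + num k) * e (5 ℕ.+ k) + ((num 1 + num k) * e (3 ℕ.+ k) * e 2
                                   + (num 3 + num k) * e (4 ℕ.+ k) * e 1))
    A-split k = solve 4 (λ A u v w → A := A :- u :- v :- w :+ (u :+ (v :+ w))) refl
      (A k) ((num 5 + num k) * e (5 ℕ.+ k)) ((num 1 + num k) * e (3 ℕ.+ k) * e 2) ((num 3 + num k) * e (4 ℕ.+ k) * e 1)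

    triangle : Fin m → Fin m → Fin m → Carrier
    triangle a b d = distinct a b * (distinct a d * distinct b d) * (x a * x b)

    ∑-triangle : ∀ d → ∑ (λ a → ∑ (λ b → triangle a b d)) ≈ num 2 * ē 2 d
    ∑-triangle d = begin
      ∑ (λ a → ∑ (λ b → triangle a b d))
        ≈⟨ ∑-cong inner ⟩
      ∑ (λ a → distinct d a * (x a * (e 1 - x d - x a)))
        ≈⟨ ∑-distinct d (λ a → x a * (e 1 - x d - x a)) ⟩
      ∑ (λ a → x a * (e 1 - x d - x a)) - x d * (e 1 - x d - x d)
        ≈⟨ +-congʳ (∑-cong (λ a → solve 3 (λ e y z → z :* (e :- y :- z) := (e :- y) :* z :+ (:- n 1) :* (z :* z))
             refl (e 1) (x d) (x a))) ⟩
      ∑ (λ a → (e 1 - x d) * x a + - num 1 * (x a * x a)) - x d * (e 1 - x d - x d)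
        ≈⟨ +-congʳ (trans (∑-snoc (- num 1) (λ a → x a * x a) (∑-* (e 1 - x d) x)) (+-congʳ (*-congˡ newton₁))) ⟩
      (e 1 - x d) * e 1 + - num 1 * p₂ - x d * (e 1 - x d - x d)
        ≈⟨ drop newton₂ (- num 1) (solve 4 (λ a b y p →
             (a :- y) :* a :+ (:- n 1) :* p :- y :* (a :- y :- y)
             := n 2 :* (b :- a :* y :+ y :* y) :+ (:- n 1) :* (n 2 :* b :- (a :* a :- p)))
             refl (e 1) (e 2) (x d) p₂) ⟩
      num 2 * (e 2 - e 1 * x d + x d * x d)
        ≈⟨ *-congˡ (ē₂ d) ⟨
      num 2 * ē 2 d ∎
      where
      inner : ∀ a → ∑ (λ b → triangle a b d) ≈ distinct d a * (x a * (e 1 - x d - x a))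
      inner a = begin
        ∑ (λ b → triangle a b d)
          ≈⟨ ∑-cong (λ b → trans (*-congʳ (*-congˡ (*-cong (distinct-sym a d) (distinct-sym b d))))
               (solve 5 (λ u v w y z → u :* (v :* w) :* (y :* z) := v :* y :* (u :* (w :* z)))
                 refl (distinct a b) (distinct d a) (distinct d b) (x a) (x b))) ⟩
        ∑ (λ b → distinct d a * x a * (distinct a b * (distinct d b * x b)))
          ≈⟨ ∑-* (distinct d a * x a) (λ b → distinct a b * (distinct d b * x b)) ⟩
        distinct d a * x a * ∑ (λ b → distinct a b * (distinct d b * x b))
          ≈⟨ *-congˡ (trans (∑-distinct a (λ b → distinct d b * x b)) (+-congʳ (trans (∑-distinct d x) (+-congʳ newton₁)))) ⟩
        distinct d a * x a * (e 1 - x d - distinct d a * x a)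
          ≈⟨ drop (distinct-idem d a) (- (x a * x a)) (solve 4 (λ u y z e →
               u :* z :* (e :- y :- u :* z) := u :* (z :* (e :- y :- z)) :+ (:- (z :* z)) :* (u :* u :- u))
               refl (distinct d a) (x d) (x a) (e 1)) ⟩
        distinct d a * (x a * (e 1 - x d - x a)) ∎

    colorSum : ∀ k → (Vec (Fin m) k → Carrier) → Carrier
    colorSum zero    f = f []
    colorSum (suc k) f = ∑ (λ i → colorSum k (λ κ → f (i ∷ κ)))

    colorSum-cong : ∀ k {f g} → (∀ κ → f κ ≈ g κ) → colorSum k f ≈ colorSum k g
    colorSum-cong zero    p = p []
    colorSum-cong (suc k) p = ∑-cong (λ i → colorSum-cong k (λ κ → p (i ∷ κ)))

    colorSum-* : ∀ k a f → colorSum k (λ κ → a * f κ) ≈ a * colorSum k f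
    colorSum-* zero    a f = refl
    colorSum-* (suc k) a f = trans (∑-cong (λ i → colorSum-* k a (λ κ → f (i ∷ κ)))) (∑-* a (λ i → colorSum k (λ κ → f (i ∷ κ))))

    weight : ∀ {k} → Vec (Fin m) k → Carrier
    weight []      = 1#
    weight (i ∷ κ) = x i * weight κ

    -- The indicator of a proper coloring c, d, κ of a path whose last vertex has a twin of color b.
    endTwinned : ∀ {k} → Fin m → Fin m → Fin m → Vec (Fin m) k → Carrier
    endTwinned b c d []      = distinct c d * (distinct b c * distinct b d)
    endTwinned b c d (i ∷ κ) = distinct c d * endTwinned b d i κ

    bothTwinned : ∀ {k} → Vec (Fin m) (5 ℕ.+ k) → Carrier
    bothTwinned (b ∷ a ∷ c ∷ d ∷ κ) = distinct a c * distinct a d * endTwinned b c d κ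

    tails : ℕ → Fin m → Fin m → Fin m → Carrier
    tails k b c d = colorSum k (λ κ → endTwinned b c d κ * weight (c ∷ d ∷ κ))

    starts : ℕ → Fin m → Carrier
    starts k c = ∑ (λ b → x b * ∑ (tails k b c))

    tails-suc : ∀ k b c d → tails (suc k) b c d ≈ distinct c d * x c * ∑ (tails k b d)
    tails-suc k b c d = trans (∑-cong λ i → trans (colorSum-cong k λ κ →
        solve 4 (λ u v y w → u :* v :* (y :* w) := u :* y :* (v :* w)) refl
          (distinct c d) (endTwinned b d i κ) (x c) (weight (d ∷ i ∷ κ)))
        (colorSum-* k (distinct c d * x c) (λ κ → endTwinned b d i κ * weight (d ∷ i ∷ κ))))
      (∑-* (distinct c d * x c) (tails k b d))

    starts-zero : ∀ c → starts 0 c ≈ num 2 * (x c * ē 2 c)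
    starts-zero c = begin
      ∑ (λ b → x b * ∑ (tails 0 b c))
        ≈⟨ ∑-cong (λ b → *-distribˡ-sum (x b) (tails 0 b c)) ⟩
      ∑ (λ b → ∑ (λ d → x b * tails 0 b c d))
        ≈⟨ ∑-cong (λ b → trans (∑-cong (λ d → trans (*-congˡ (*-cong (*-congʳ (distinct-sym c d)) (*-congˡ (*-identityʳ (x d)))))
             (solve 6 (λ u v w y z t → y :* (u :* (v :* w) :* (z :* t)) := z :* (w :* (v :* u) :* (y :* t)))
               refl (distinct d c) (distinct b c) (distinct b d) (x b) (x c) (x d))))
             (∑-* (x c) (λ d → triangle b d c))) ⟩
      ∑ (λ b → x c * ∑ (λ d → triangle b d c))
        ≈⟨ ∑-* (x c) (λ b → ∑ (λ d → triangle b d c)) ⟩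
      x c * ∑ (λ b → ∑ (λ d → triangle b d c))
        ≈⟨ *-congˡ (∑-triangle c) ⟩
      x c * (num 2 * ē 2 c)
        ≈⟨ solve 2 (λ y z → y :* (n 2 :* z) := n 2 :* (y :* z)) refl (x c) (ē 2 c) ⟩
      num 2 * (x c * ē 2 c) ∎

    starts-suc : ∀ k c → starts (suc k) c ≈ step (starts k) c
    starts-suc k c = begin
      ∑ (λ b → x b * ∑ (tails (suc k) b c))
        ≈⟨ ∑-cong (λ b → trans (*-distribˡ-sum (x b) (tails (suc k) b c)) (∑-cong λ d → trans (*-congˡ (tails-suc k b c d))
             (solve 4 (λ u y z t → y :* (u :* z :* t) := z :* (u :* (y :* t))) refl
               (distinct c d) (x b) (x c) (∑ (tails k b d))))) ⟩
      ∑ (λ b → ∑ (λ d → x c * (distinct c d * (x b * ∑ (tails k b d)))))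
        ≈⟨ ∑-comm (λ b d → x c * (distinct c d * (x b * ∑ (tails k b d)))) ⟩
      ∑ (λ d → ∑ (λ b → x c * (distinct c d * (x b * ∑ (tails k b d)))))
        ≈⟨ ∑-cong (λ d → trans (∑-* (x c) (λ b → distinct c d * (x b * ∑ (tails k b d))))
             (*-congˡ (∑-* (distinct c d) (λ b → x b * ∑ (tails k b d))))) ⟩
      ∑ (λ d → x c * (distinct c d * starts k d))
        ≈⟨ ∑-* (x c) (λ d → distinct c d * starts k d) ⟩
      x c * ∑ (λ d → distinct c d * starts k d)
        ≈⟨ *-congˡ (∑-distinct c (starts k)) ⟩
      step (starts k) c ∎

    starts-twinWalk : ∀ k c → starts k c ≈ num 2 * twinWalk k c
    starts-twinWalk zero    c = trans (starts-zero c) (*-congˡ (walk₂ c))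
    starts-twinWalk (suc k) c = begin
      starts (suc k) c                       ≈⟨ starts-suc k c ⟩
      step (starts k) c                      ≈⟨ step-cong (starts-twinWalk k) c ⟩
      step (λ j → num 2 * twinWalk k j) c    ≈⟨ *-congˡ (+-congʳ (∑-* (num 2) (twinWalk k))) ⟩
      x c * (num 2 * ∑ (twinWalk k) - num 2 * twinWalk k c)
        ≈⟨ solve 3 (λ y S t → y :* (n 2 :* S :- n 2 :* t) := n 2 :* (y :* (S :- t))) refl (x c) (∑ (twinWalk k)) (twinWalk k c) ⟩
      num 2 * step (twinWalk k) c            ≈⟨ *-congˡ (step-twinWalk k c) ⟩
      num 2 * twinWalk (suc k) c             ∎

    ∑-exchange : ∀ (t : Fin m → Fin m → Fin m → Carrier) (g : Fin m → Fin m → Carrier) →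
      ∑ (λ b → ∑ (λ a → ∑ (λ c → ∑ (λ d → t a c d * g b d))))
      ≈ ∑ (λ d → ∑ (λ a → ∑ (λ c → t a c d)) * ∑ (λ b → g b d))
    ∑-exchange t g = begin
      ∑ (λ b → ∑ (λ a → ∑ (λ c → ∑ (λ d → t a c d * g b d))))
        ≈⟨ ∑-cong (λ b → ∑-cong λ a → trans (∑-comm (λ c d → t a c d * g b d))
             (∑-cong λ d → sym (*-distribʳ-sum (g b d) (λ c → t a c d)))) ⟩
      ∑ (λ b → ∑ (λ a → ∑ (λ d → ∑ (λ c → t a c d) * g b d)))
        ≈⟨ ∑-cong (λ b → trans (∑-comm (λ a d → ∑ (λ c → t a c d) * g b d))
             (∑-cong λ d → sym (*-distribʳ-sum (g b d) (λ a → ∑ (λ c → t a c d))))) ⟩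
      ∑ (λ b → ∑ (λ d → ∑ (λ a → ∑ (λ c → t a c d)) * g b d))
        ≈⟨ ∑-comm (λ b d → ∑ (λ a → ∑ (λ c → t a c d)) * g b d) ⟩
      ∑ (λ d → ∑ (λ b → ∑ (λ a → ∑ (λ c → t a c d)) * g b d))
        ≈⟨ ∑-cong (λ d → ∑-* (∑ (λ a → ∑ (λ c → t a c d))) (λ b → g b d)) ⟩
      ∑ (λ d → ∑ (λ a → ∑ (λ c → t a c d)) * ∑ (λ b → g b d)) ∎

    colorSum-twinned : ∀ k → colorSum (5 ℕ.+ k) (λ κ → bothTwinned κ * weight κ) ≈ num 4 * A k
    colorSum-twinned k = begin
      colorSum (5 ℕ.+ k) (λ κ → bothTwinned κ * weight κ)
        ≈⟨ ∑-cong (λ b → ∑-cong λ a → ∑-cong λ c → ∑-cong λ d → trans (colorSum-cong (suc k) λ κ →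
             solve 6 (λ u v w y z t → u :* v :* w :* (y :* (z :* t)) := u :* v :* (y :* z) :* (w :* t))
               refl (distinct a c) (distinct a d) (endTwinned b c d κ) (x b) (x a) (weight (c ∷ d ∷ κ)))
             (colorSum-* (suc k) (distinct a c * distinct a d * (x b * x a)) (λ κ → endTwinned b c d κ * weight (c ∷ d ∷ κ)))) ⟩
      ∑ (λ b → ∑ (λ a → ∑ (λ c → ∑ (λ d → distinct a c * distinct a d * (x b * x a) * tails (suc k) b c d))))
        ≈⟨ ∑-cong (λ b → ∑-cong λ a → ∑-cong λ c → ∑-cong λ d → trans (*-congˡ (tails-suc k b c d))
             (solve 7 (λ u v w y z t h → u :* v :* (y :* z) :* (w :* t :* h) := u :* (v :* w) :* (z :* t) :* (y :* h))
               refl (distinct a c) (distinct a d) (distinct c d) (x b) (x a) (x c) (∑ (tails k b d)))) ⟩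
      ∑ (λ b → ∑ (λ a → ∑ (λ c → ∑ (λ d → triangle a c d * (x b * ∑ (tails k b d))))))
        ≈⟨ ∑-exchange triangle (λ b d → x b * ∑ (tails k b d)) ⟩
      ∑ (λ d → ∑ (λ a → ∑ (λ c → triangle a c d)) * starts k d)
        ≈⟨ ∑-cong (λ d → trans (*-cong (∑-triangle d) (starts-twinWalk k d))
             (solve 2 (λ y z → n 2 :* y :* (n 2 :* z) := n 4 :* (y :* z)) refl (ē 2 d) (twinWalk k d))) ⟩
      ∑ (λ d → num 4 * (ē 2 d * twinWalk k d))
        ≈⟨ trans (∑-* (num 4) (λ d → ē 2 d * twinWalk k d)) (*-congˡ (∑-ē₂-twinWalk k)) ⟩
      num 4 * A k ∎

    complete₄ : Vec (Fin m) 4 → Carrier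
    complete₄ (b ∷ a ∷ c ∷ d ∷ []) = distinct a b * (distinct a c * distinct a d * endTwinned b c d [])

    colorSum-complete₄ : colorSum 4 (λ κ → complete₄ κ * weight κ) ≈ num 24 * e 4
    colorSum-complete₄ = begin
      ∑ (λ b → ∑ (λ a → ∑ (λ c → ∑ (λ d → complete₄ (b ∷ a ∷ c ∷ d ∷ []) * weight (b ∷ a ∷ c ∷ d ∷ [])))))
        ≈⟨ ∑-cong (λ b → trans (∑-cong λ a → trans (∑-cong λ c → fourth b a c) (third b a)) (second b)) ⟩
      ∑ (λ b → x b * (e 1 * e 1 * e 1 - num 3 * e 1 * p₂ + num 2 * p₃
               + x b * (num 3 * p₂ - num 3 * e 1 * e 1) + num 6 * e 1 * (x b * x b) - num 6 * (x b * x b * x b)))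
        ≈⟨ ∑-cong (λ b → solve 4 (λ a p q y →
             y :* (a :* a :* a :- n 3 :* a :* p :+ n 2 :* q
                   :+ y :* (n 3 :* p :- n 3 :* a :* a) :+ n 6 :* a :* (y :* y) :- n 6 :* (y :* y :* y))
             := (a :* a :* a :- n 3 :* a :* p :+ n 2 :* q) :* y :+ (n 3 :* p :- n 3 :* a :* a) :* (y :* y)
                :+ (n 6 :* a) :* (y :* y :* y) :+ (:- n 6) :* (y :* y :* y :* y))
             refl (e 1) p₂ p₃ (x b)) ⟩
      ∑ (λ b → (e 1 * e 1 * e 1 - num 3 * e 1 * p₂ + num 2 * p₃) * x b + (num 3 * p₂ - num 3 * e 1 * e 1) * (x b * x b)
               + (num 6 * e 1) * (x b * x b * x b) + - num 6 * (x b * x b * x b * x b))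
        ≈⟨ trans (∑-snoc (- num 6) (λ b → x b * x b * x b * x b) (∑-snoc (num 6 * e 1) (λ b → x b * x b * x b)
             (∑-snoc (num 3 * p₂ - num 3 * e 1 * e 1) (λ b → x b * x b)
               (∑-* (e 1 * e 1 * e 1 - num 3 * e 1 * p₂ + num 2 * p₃) x))))
             (+-congʳ (+-congʳ (+-congʳ (*-congˡ newton₁)))) ⟩
      (e 1 * e 1 * e 1 - num 3 * e 1 * p₂ + num 2 * p₃) * e 1 + (num 3 * p₂ - num 3 * e 1 * e 1) * p₂
        + (num 6 * e 1) * p₃ + - num 6 * p₄
        ≈⟨ drop newton₄ (- num 6) (drop newton₃ (- (num 2 * e 1)) (drop newton₂ (num 3 * p₂ - e 1 * e 1)
           (solve 7 (λ a b c d p q r →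
             (a :* a :* a :- n 3 :* a :* p :+ n 2 :* q) :* a :+ (n 3 :* p :- n 3 :* a :* a) :* p
               :+ (n 6 :* a) :* q :+ (:- n 6) :* r
             := n 24 :* d :+ (:- n 6) :* (n 4 :* d :- (c :* a :- b :* p :+ a :* q :- r))
                :+ (:- (n 2 :* a)) :* (n 3 :* c :- (b :* a :- a :* p :+ q))
                :+ (n 3 :* p :- a :* a) :* (n 2 :* b :- (a :* a :- p)))
             refl (e 1) (e 2) (e 3) (e 4) p₂ p₃ p₄))) ⟩
      num 24 * e 4 ∎
      where
      fourth : ∀ b a c → ∑ (λ d → complete₄ (b ∷ a ∷ c ∷ d ∷ []) * weight (b ∷ a ∷ c ∷ d ∷ []))
                         ≈ distinct b a * (x b * x a) * (distinct a c * (distinct b c * (x c * (e 1 - x b - x a - x c))))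
      fourth b a c = begin
        ∑ (λ d → complete₄ (b ∷ a ∷ c ∷ d ∷ []) * weight (b ∷ a ∷ c ∷ d ∷ []))
          ≈⟨ ∑-cong (λ d → trans (*-cong (*-congʳ (distinct-sym a b)) (*-congˡ (*-congˡ (*-congˡ (*-identityʳ (x d))))))
               (solve 10 (λ ab ac ad cd bc bd xa xb xc xd →
                  ab :* (ac :* ad :* (cd :* (bc :* bd))) :* (xb :* (xa :* (xc :* xd)))
                  := ab :* ac :* bc :* (xb :* xa :* xc) :* (ad :* (cd :* (bd :* xd))))
                 refl (distinct b a) (distinct a c) (distinct a d) (distinct c d) (distinct b c) (distinct b d)
                 (x a) (x b) (x c) (x d))) ⟩
        ∑ (λ d → distinct b a * distinct a c * distinct b c * (x b * x a * x c)
                 * (distinct a d * (distinct c d * (distinct b d * x d))))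
          ≈⟨ ∑-* (distinct b a * distinct a c * distinct b c * (x b * x a * x c)) (λ d → distinct a d * (distinct c d * (distinct b d * x d))) ⟩
        distinct b a * distinct a c * distinct b c * (x b * x a * x c)
          * ∑ (λ d → distinct a d * (distinct c d * (distinct b d * x d)))
          ≈⟨ *-congˡ (trans (∑-distinct a (λ d → distinct c d * (distinct b d * x d)))
               (+-cong (trans (∑-distinct c (λ d → distinct b d * x d)) (+-congʳ (trans (∑-distinct b x) (+-congʳ newton₁))))
                 (-‿cong (*-congʳ (distinct-sym c a))))) ⟩
        distinct b a * distinct a c * distinct b c * (x b * x a * x c)
          * (e 1 - x b - distinct b c * x c - distinct a c * (distinct b a * x a))
          ≈⟨ drop (distinct-idem b c) (- (distinct b a * distinct a c * (x b * x a * x c) * x c))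
             (drop (distinct-idem a c) (- (distinct b a * distinct b a * distinct b c * (x b * x a * x c) * x a))
             (drop (distinct-idem b a) (- (distinct a c * distinct b c * (x b * x a * x c) * x a))
             (solve 7 (λ ab ac bc xa xb xc s →
                ab :* ac :* bc :* (xb :* xa :* xc) :* (s :- xb :- bc :* xc :- ac :* (ab :* xa))
                := ab :* (xb :* xa) :* (ac :* (bc :* (xc :* (s :- xb :- xa :- xc))))
                   :+ (:- (ab :* ac :* (xb :* xa :* xc) :* xc)) :* (bc :* bc :- bc)
                   :+ (:- (ab :* ab :* bc :* (xb :* xa :* xc) :* xa)) :* (ac :* ac :- ac)
                   :+ (:- (ac :* bc :* (xb :* xa :* xc) :* xa)) :* (ab :* ab :- ab))
                refl (distinct b a) (distinct a c) (distinct b c) (x a) (x b) (x c) (e 1)))) ⟩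
        distinct b a * (x b * x a) * (distinct a c * (distinct b c * (x c * (e 1 - x b - x a - x c)))) ∎

      third : ∀ b a → ∑ (λ c → distinct b a * (x b * x a) * (distinct a c * (distinct b c * (x c * (e 1 - x b - x a - x c)))))
                      ≈ x b * (distinct b a * (x a * (e 1 * e 1 - p₂ - num 2 * e 1 * x b + num 2 * (x b * x b)
                                 + (num 2 * x b - num 2 * e 1) * x a + num 2 * (x a * x a))))
      third b a = begin
        ∑ (λ c → distinct b a * (x b * x a) * (distinct a c * (distinct b c * f c)))
          ≈⟨ ∑-* (distinct b a * (x b * x a)) (λ c → distinct a c * (distinct b c * f c)) ⟩
        distinct b a * (x b * x a) * ∑ (λ c → distinct a c * (distinct b c * f c))
          ≈⟨ *-congˡ (trans (∑-distinct a (λ c → distinct b c * f c)) (+-congʳ (trans (∑-distinct b f) (+-congʳ ∑f)))) ⟩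
        distinct b a * (x b * x a) * ((e 1 - x b - x a) * e 1 + - num 1 * p₂ - f b - distinct b a * f a)
          ≈⟨ drop (distinct-idem b a) (- (x b * x a * f a)) (solve 5 (λ ab xa xb s p →
               ab :* (xb :* xa) :* ((s :- xb :- xa) :* s :+ (:- n 1) :* p :- xb :* (s :- xb :- xa :- xb)
                                    :- ab :* (xa :* (s :- xb :- xa :- xa)))
               := xb :* (ab :* (xa :* (s :* s :- p :- n 2 :* s :* xb :+ n 2 :* (xb :* xb)
                                 :+ (n 2 :* xb :- n 2 :* s) :* xa :+ n 2 :* (xa :* xa))))
                  :+ (:- (xb :* xa :* (xa :* (s :- xb :- xa :- xa)))) :* (ab :* ab :- ab))
               refl (distinct b a) (x a) (x b) (e 1) p₂) ⟩
        x b * (distinct b a * (x a * (e 1 * e 1 - p₂ - num 2 * e 1 * x b + num 2 * (x b * x b)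
                                 + (num 2 * x b - num 2 * e 1) * x a + num 2 * (x a * x a)))) ∎
        where
        f : Fin m → Carrier
        f c = x c * (e 1 - x b - x a - x c)
        ∑f : ∑ f ≈ (e 1 - x b - x a) * e 1 + - num 1 * p₂
        ∑f = trans (∑-cong (λ c → solve 2 (λ s y → y :* (s :- y) := s :* y :+ (:- n 1) :* (y :* y)) refl (e 1 - x b - x a) (x c)))
          (trans (∑-snoc (- num 1) (λ c → x c * x c) (∑-* (e 1 - x b - x a) x)) (+-congʳ (*-congˡ newton₁)))

      second : ∀ b → ∑ (λ a → x b * (distinct b a * (x a * (e 1 * e 1 - p₂ - num 2 * e 1 * x b + num 2 * (x b * x b)
                                 + (num 2 * x b - num 2 * e 1) * x a + num 2 * (x a * x a)))))
                     ≈ x b * (e 1 * e 1 * e 1 - num 3 * e 1 * p₂ + num 2 * p₃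
                         + x b * (num 3 * p₂ - num 3 * e 1 * e 1) + num 6 * e 1 * (x b * x b) - num 6 * (x b * x b * x b))
      second b = begin
        ∑ (λ a → x b * (distinct b a * f a))
          ≈⟨ ∑-* (x b) (λ a → distinct b a * f a) ⟩
        x b * ∑ (λ a → distinct b a * f a)
          ≈⟨ *-congˡ (trans (∑-distinct b f) (+-congʳ ∑f)) ⟩
        x b * (u * e 1 + v * p₂ + num 2 * p₃ - f b)
          ≈⟨ *-congˡ (solve 4 (λ s y p q →
               (s :* s :- p :- n 2 :* s :* y :+ n 2 :* (y :* y)) :* s :+ (n 2 :* y :- n 2 :* s) :* p :+ n 2 :* q
                 :- y :* (s :* s :- p :- n 2 :* s :* y :+ n 2 :* (y :* y) :+ (n 2 :* y :- n 2 :* s) :* y :+ n 2 :* (y :* y))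
               := s :* s :* s :- n 3 :* s :* p :+ n 2 :* q :+ y :* (n 3 :* p :- n 3 :* s :* s)
                  :+ n 6 :* s :* (y :* y) :- n 6 :* (y :* y :* y))
               refl (e 1) (x b) p₂ p₃) ⟩
        x b * (e 1 * e 1 * e 1 - num 3 * e 1 * p₂ + num 2 * p₃
                + x b * (num 3 * p₂ - num 3 * e 1 * e 1) + num 6 * e 1 * (x b * x b) - num 6 * (x b * x b * x b)) ∎
        where
        u v : Carrier
        u = e 1 * e 1 - p₂ - num 2 * e 1 * x b + num 2 * (x b * x b)
        v = num 2 * x b - num 2 * e 1
        f : Fin m → Carrier
        f a = x a * (u + v * x a + num 2 * (x a * x a))
        ∑f : ∑ f ≈ u * e 1 + v * p₂ + num 2 * p₃
        ∑f = trans (∑-cong (λ a → solve 3 (λ u v y → y :* (u :+ v :* y :+ n 2 :* (y :* y))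
                                       := u :* y :+ v :* (y :* y) :+ n 2 :* (y :* y :* y)) refl u v (x a)))
          (trans (∑-snoc (num 2) (λ a → x a * x a * x a) (∑-snoc v (λ a → x a * x a) (∑-* u x)))
            (+-congʳ (+-congʳ (*-congˡ newton₁))))

open import Defs
open import Algebra.Properties.CommutativeMonoid.Sum ℚ.+-0-commutativeMonoid using () renaming (sum to ∑ℚ; sum-cong-≗ to ∑ℚ-cong; sum-replicate-zero to ∑ℚ-zero)
open import Algebra.Properties.CommutativeSemigroup (CommutativeMonoid.commutativeSemigroup ℚ.+-0-commutativeMonoid) using (x∙yz≈y∙xz)
open import Algebra.Structures using (IsCommutativeRing)
open import Data.Bool.Properties using (∧-zeroʳ)
open import Data.Fin using (fromℕ)
open import Data.List using (filter; length; upTo; applyUpTo; tabulate; allFin)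
open import Data.List.Properties using (≡-dec; map-cong; map-upTo)
open import Data.List.Relation.Binary.Permutation.Propositional using (_↭_; ↭-sym; prep; swap) renaming (refl to ↭-refl; trans to ↭-trans)
open import Data.List.Relation.Binary.Permutation.Propositional.Properties using (All-resp-↭)
open import Data.List.Relation.Unary.All using (All; []; _∷_)
open import Data.List.Relation.Unary.All.Properties using (++⁺)
open import Data.List.Relation.Unary.AllPairs using ([]; _∷_)
open import Data.List.Relation.Unary.Unique.Propositional using (Unique)
import Data.List.Sort as Sort
open import Data.Nat using (_+_; _*_; _∸_; _≤_; _<_; _≟_; _≤?_; _≡ᵇ_; z≤n; s≤s)
open import Data.Nat.Induction using (<-rec)
import Data.Nat.Properties as ℕ
open import Data.Product using (Σ; _×_; proj₁; proj₂; map₂)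
open import Data.Rational using (0ℚ; 1ℚ; nonNegative) renaming (_+_ to _+ℚ_; _*_ to _*ℚ_; -_ to -ℚ_; _≤_ to _≤ℚ_)
open import Data.Sum using (inj₁; inj₂)
open import Data.Vec using (lookup; zipWith; count) renaming (tabulate to tabulateᵛ)
import Data.Vec.Properties as Vec
import Data.Vec.Relation.Unary.All as VecAll
open import Function using (id; _⇔_; mk⇔; Equivalence)
open import Relation.Binary.Construct.Flip.EqAndOrd using (decTotalOrder)
open import Relation.Binary.PropositionalEquality using (_≡_; _≢_; refl; sym; trans; cong; cong₂; ≢-sym; _→-setoid_; module ≡-Reasoning)
open import Relation.Nullary.Decidable using (_×-dec_; ¬?; does-⇔)
open import Relation.Unary using (Decidable)

open ListSum ℚ.+-0-commutativeMonoid using (∑ᴸ; ∑ᴸ-product)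

module Coefficients (m : ℕ) where

  Coeffs : Set
  Coeffs = Vec ℕ m → ℚ

  infix 4 _≗ᶜ_
  _≗ᶜ_ : Coeffs → Coeffs → Set
  f ≗ᶜ g = ∀ α → f α ≡ g α

  infixl 6 _⊞_
  _⊞_ : Coeffs → Coeffs → Coeffs
  (f ⊞ g) α = f α +ℚ g α

  infixl 7 _⊛_
  _⊛_ : Coeffs → Coeffs → Coeffs
  (f ⊛ g) α = foldr _+ℚ_ 0ℚ (map (λ β → f β *ℚ g (zipWith _∸_ α β)) (divisors α))

  IsCoeffRing : Set
  IsCoeffRing = IsCommutativeRing _≗ᶜ_ _⊞_ _⊛_ (λ f α → -ℚ f α) (𝟘 m) (𝟙 m)

  toRing : IsCoeffRing → CommutativeRing 0ℓ 0ℓ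
  toRing is = record { isCommutativeRing = is }

module _ {m : ℕ} (is : Coefficients.IsCoeffRing m) where

  open Coefficients (suc m)
  open Coefficients m using () renaming (Coeffs to Coeffsₘ; _⊛_ to _⊛ₘ_; toRing to toRingₘ)
  open CauchyProduct (toRingₘ is)
  private module PS = CommutativeRing powerSeriesRing

  slices : Coeffs → ℕ → Coeffsₘ
  slices f a β = f (a ∷ β)

  sum-conv : ∀ (f g : ℕ → Coeffsₘ) a α →
             foldr _+ℚ_ 0ℚ (applyUpTo (λ i → (f i ⊛ₘ g (a ∸ i)) α) (suc a)) ≡ conv f g a α
  sum-conv f g zero    α = ℚ.+-identityʳ _
  sum-conv f g (suc a) α = cong ((f 0 ⊛ₘ g (suc a)) α +ℚ_) (sum-conv (f ∘ suc) g a α)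

  ⊛-slices : ∀ f g → slices (f ⊛ g) PS.≈ conv (slices f) (slices g)
  ⊛-slices f g a α = begin
    (f ⊛ g) (a ∷ α)
      ≡⟨ ∑ᴸ-product (λ β → f β *ℚ g (zipWith _∸_ (a ∷ α) β)) _∷_ (upTo (suc a)) (divisors α) ⟩
    foldr _+ℚ_ 0ℚ (map (λ i → (slices f i ⊛ₘ slices g (a ∸ i)) α) (upTo (suc a)))
      ≡⟨ cong (foldr _+ℚ_ 0ℚ) (map-upTo (λ i → (slices f i ⊛ₘ slices g (a ∸ i)) α) (suc a)) ⟩
    foldr _+ℚ_ 0ℚ (applyUpTo (λ i → (slices f i ⊛ₘ slices g (a ∸ i)) α) (suc a))
      ≡⟨ sum-conv (slices f) (slices g) a α ⟩
    conv (slices f) (slices g) a α ∎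
    where open ≡-Reasoning

  𝟙-slices : slices (𝟙 (suc m)) PS.≈ PS.1#
  𝟙-slices zero    α = refl
  𝟙-slices (suc a) α = refl

  isCoeffRing-suc : IsCoeffRing
  isCoeffRing-suc = record
    { isRing = record
      { +-isAbelianGroup = Pointwise.isAbelianGroup (Vec ℕ (suc m)) ℚ.+-0-isAbelianGroup
      ; *-cong           = λ {f} {f′} {g} {g′} p q → unslice (PS.trans (⊛-slices f g)
                             (PS.trans (PS.*-cong (λ a α → p (a ∷ α)) (λ a α → q (a ∷ α)))
                               (PS.sym (⊛-slices f′ g′))))
      ; *-assoc          = λ f g h → unslice (begin
          slices ((f ⊛ g) ⊛ h)                       ≈⟨ ⊛-slices (f ⊛ g) h ⟩
          conv (slices (f ⊛ g)) (slices h)           ≈⟨ PS.*-congʳ (⊛-slices f g) ⟩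
          conv (conv (slices f) (slices g)) (slices h) ≈⟨ conv-assoc (slices f) (slices g) (slices h) ⟩
          conv (slices f) (conv (slices g) (slices h)) ≈⟨ PS.*-congˡ {slices f} (⊛-slices g h) ⟨
          conv (slices f) (slices (g ⊛ h))           ≈⟨ ⊛-slices f (g ⊛ h) ⟨
          slices (f ⊛ (g ⊛ h))                       ∎)
      ; *-identity       = comm∧idˡ⇒id comm {𝟙 (suc m)} λ f → unslice (begin
          slices (𝟙 (suc m) ⊛ f)             ≈⟨ ⊛-slices (𝟙 (suc m)) f ⟩
          conv (slices (𝟙 (suc m))) (slices f) ≈⟨ PS.*-congʳ 𝟙-slices ⟩
          conv PS.1# (slices f)              ≈⟨ PS.*-identityˡ (slices f) ⟩
          slices f                           ∎)
      ; distrib          = comm∧distrˡ⇒distr +-cong comm λ f g h → unslice (begin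
          slices (f ⊛ (g ⊞ h))              ≈⟨ ⊛-slices f (g ⊞ h) ⟩
          conv (slices f) (slices g PS.+ slices h)      ≈⟨ conv-distribˡ (slices f) (slices g) (slices h) ⟩
          conv (slices f) (slices g) PS.+ conv (slices f) (slices h)
            ≈⟨ PS.+-cong (⊛-slices f g) (⊛-slices f h) ⟨
          slices (f ⊛ g) PS.+ slices (f ⊛ h)            ∎)
      }
    ; *-comm = comm
    }
    where
    open import Relation.Binary.Reasoning.Setoid PS.setoid
    open Consequences (Vec ℕ (suc m) →-setoid ℚ)
      using (comm∧idˡ⇒id; comm∧distrˡ⇒distr)
    unslice : ∀ {f g} → slices f PS.≈ slices g → f ≗ᶜ g
    unslice p (a ∷ α) = p a α
    comm : ∀ f g → (f ⊛ g) ≗ᶜ (g ⊛ f)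
    comm f g = unslice (PS.trans (⊛-slices f g)
      (PS.trans (conv-comm (slices f) (slices g)) (PS.sym (⊛-slices g f))))
    +-cong : ∀ {f f′ g g′ : Coeffs} → f ≗ᶜ f′ → g ≗ᶜ g′ → (λ α → f α +ℚ g α) ≗ᶜ (λ α → f′ α +ℚ g′ α)
    +-cong p q α = cong₂ _+ℚ_ (p α) (q α)

isCoeffRing : ∀ m → Coefficients.IsCoeffRing m
isCoeffRing zero = record
  { isRing = record
    { +-isAbelianGroup = Pointwise.isAbelianGroup (Vec ℕ 0) ℚ.+-0-isAbelianGroup
    ; *-cong           = λ { p q [] → cong₂ (λ a b → a *ℚ b +ℚ 0ℚ) (p []) (q []) }
    ; *-assoc          = λ { f g h [] → trans (⊛[] (f ⊛ g) h) (trans (cong (_*ℚ h []) (⊛[] f g))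
                           (trans (ℚ.*-assoc (f []) (g []) (h []))
                             (trans (cong (f [] *ℚ_) (sym (⊛[] g h))) (sym (⊛[] f (g ⊛ h)))))) }
    ; *-identity       = (λ { f [] → trans (⊛[] (𝟙 0) f) (ℚ.*-identityˡ (f [])) })
                       , (λ { f [] → trans (⊛[] f (𝟙 0)) (ℚ.*-identityʳ (f [])) })
    ; distrib          = (λ { f g h [] → trans (⊛[] f (g ⊞ h)) (trans (ℚ.*-distribˡ-+ (f []) (g []) (h []))
                           (sym (cong₂ _+ℚ_ (⊛[] f g) (⊛[] f h)))) })
                       , (λ { f g h [] → trans (⊛[] (g ⊞ h) f) (trans (ℚ.*-distribʳ-+ (f []) (g []) (h []))
                           (sym (cong₂ _+ℚ_ (⊛[] g f) (⊛[] h f)))) })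
    }
  ; *-comm = λ { f g [] → cong (_+ℚ 0ℚ) (ℚ.*-comm (f []) (g [])) }
  }
  where
  open Coefficients 0
  ⊛[] : ∀ f g → (f ⊛ g) [] ≡ f [] *ℚ g []
  ⊛[] f g = ℚ.+-identityʳ _
isCoeffRing (suc m) = isCoeffRing-suc (isCoeffRing m)

coeffRing : ℕ → CommutativeRing 0ℓ 0ℓ
coeffRing m = Coefficients.toRing m (isCoeffRing m)

private
  module R {m} = CommutativeRing (coeffRing m)

module _ {m : ℕ} where

  AvoidsNbhd : (G : Graph) → Fin (order G) → Fin m → Vec (Fin m) (order G) → Set
  AvoidsNbhd G v a κ = a ≢ lookup κ v × (∀ j → Adj G v j → a ≢ lookup κ j)

  proper-twin : ∀ G v {a : Fin m} {κ} → Proper (twin G v) (a ∷ κ) ⇔ (AvoidsNbhd G v a κ × Proper G κ)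
  proper-twin G v {a} {κ} = mk⇔
    (λ p → ((p zero (suc v) (inj₁ refl)) , (λ j adj → p zero (suc j) (inj₂ adj))) , λ i j → p (suc i) (suc j))
    λ { ((q , r) , p) → λ where
        zero    (suc j) (inj₁ refl) → q
        zero    (suc j) (inj₂ adj)  → r j adj
        (suc i) zero    (inj₁ refl) → ≢-sym q
        (suc i) zero    (inj₂ adj)  → ≢-sym (r i adj)
        (suc i) (suc j) adj         → p i j adj }

  proper-path : ∀ {k} {c d : Fin m} {κ : Vec (Fin m) k} →
                Proper (path (2 + k)) (c ∷ d ∷ κ) ⇔ (c ≢ d × Proper (path (1 + k)) (d ∷ κ))
  proper-path = mk⇔
    (λ p → p zero (suc zero) (inj₁ refl)
         , λ { i j (inj₁ q) → p (suc i) (suc j) (inj₁ (cong suc q))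
             ; i j (inj₂ q) → p (suc i) (suc j) (inj₂ (cong suc q)) })
    λ { (c≢d , p) → λ where
        zero    zero          (inj₁ ())
        zero    zero          (inj₂ ())
        zero    (suc zero)    (inj₁ _) → c≢d
        zero    (suc zero)    (inj₂ ())
        (suc zero)    zero    (inj₂ _) → ≢-sym c≢d
        (suc zero)    zero    (inj₁ ())
        (suc i) (suc j) (inj₁ q) → p i j (inj₁ (ℕ.suc-injective q))
        (suc i) (suc j) (inj₂ q) → p i j (inj₂ (ℕ.suc-injective q)) }

  avoids-first : ∀ {k} {a c d : Fin m} {κ : Vec (Fin m) k} →
                 AvoidsNbhd (path (2 + k)) zero a (c ∷ d ∷ κ) ⇔ (a ≢ c × a ≢ d)
  avoids-first = mk⇔ (λ { (p , q) → p , q (suc zero) (inj₁ refl) })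
    λ { (p , q) → p , λ where
        zero          (inj₁ ())
        zero          (inj₂ ())
        (suc zero)    _ → q
        (suc (suc j)) (inj₁ ())
        (suc (suc j)) (inj₂ ()) }

  avoids-last : ∀ {k} {b c d : Fin m} {κ : Vec (Fin m) (1 + k)} →
                AvoidsNbhd (path (3 + k)) (suc (fromℕ (1 + k))) b (c ∷ d ∷ κ)
                ⇔ AvoidsNbhd (path (2 + k)) (fromℕ (1 + k)) b (d ∷ κ)
  avoids-last = mk⇔
    (λ { (p , q) → p , λ { j (inj₁ r) → q (suc j) (inj₁ (cong suc r)) ; j (inj₂ r) → q (suc j) (inj₂ (cong suc r)) } })
    λ { (p , q) → p , λ where
        zero    (inj₁ ())
        zero    (inj₂ ())
        (suc j) (inj₁ r) → q j (inj₁ (ℕ.suc-injective r))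
        (suc j) (inj₂ r) → q j (inj₂ (ℕ.suc-injective r)) }

  EndTwinned : ∀ {k} → Fin m → Fin m → Fin m → Vec (Fin m) k → Set
  EndTwinned b c d []      = c ≢ d × (b ≢ c × b ≢ d)
  EndTwinned b c d (i ∷ κ) = c ≢ d × EndTwinned b d i κ

  endTwinned? : ∀ {k} b c d (κ : Vec (Fin m) k) → Dec (EndTwinned b c d κ)
  endTwinned? b c d []      = ¬? (c Fin.≟ d) ×-dec (¬? (b Fin.≟ c) ×-dec ¬? (b Fin.≟ d))
  endTwinned? b c d (i ∷ κ) = ¬? (c Fin.≟ d) ×-dec endTwinned? b d i κ

  open Equivalence

  endTwinned-path : ∀ {k b c d} (κ : Vec (Fin m) k) →
    EndTwinned b c d κ ⇔ (Proper (path (2 + k)) (c ∷ d ∷ κ) × AvoidsNbhd (path (2 + k)) (fromℕ (1 + k)) b (c ∷ d ∷ κ))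
  endTwinned-path [] = mk⇔
    (λ { (c≢d , b≢c , b≢d) → from proper-path (c≢d , λ { zero zero (inj₁ ()) ; zero zero (inj₂ ()) ; zero (suc ()) ; (suc ()) })
                           , b≢d , λ { zero _ → b≢c ; (suc zero) _ → b≢d } })
    λ { (p , q , r) → proj₁ (to proper-path p) , r zero (inj₂ refl) , q }
  endTwinned-path (i ∷ κ) = mk⇔
    (λ { (c≢d , t) → let p , q = to (endTwinned-path κ) t in from proper-path (c≢d , p) , from avoids-last q })
    λ { (p , q) → let c≢d , p′ = to proper-path p in c≢d , from (endTwinned-path κ) (p′ , to avoids-last q) }

  BothTwinned : ∀ {k} → Vec (Fin m) (5 + k) → Set
  BothTwinned (b ∷ a ∷ c ∷ d ∷ κ) = (a ≢ c × a ≢ d) × EndTwinned b c d κ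

  bothTwinned? : ∀ {k} (κ : Vec (Fin m) (5 + k)) → Dec (BothTwinned κ)
  bothTwinned? (b ∷ a ∷ c ∷ d ∷ κ) = (¬? (a Fin.≟ c) ×-dec ¬? (a Fin.≟ d)) ×-dec endTwinned? b c d κ

  proper-twinnedPath : ∀ {k} (κ : Vec (Fin m) (5 + k)) → Proper (twinnedPath (3 + k)) κ ⇔ BothTwinned κ
  proper-twinnedPath {k} (b ∷ a ∷ c ∷ d ∷ κ) = mk⇔
    (λ p → let (q , r) , p′ = to (proper-twin T w) p
               s , p″ = to (proper-twin (path (3 + k)) zero) p′
           in to avoids-first s , from (endTwinned-path κ) (p″ , q , λ j → r (suc j)))
    λ { (s , t) → let p″ , q , r = to (endTwinned-path κ) t in
        from (proper-twin T w) ((q , λ { zero (inj₁ ()) ; zero (inj₂ (inj₁ ())) ; zero (inj₂ (inj₂ ())) ; (suc j) → r j })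
                               , from (proper-twin (path (3 + k)) zero) (from avoids-first s , p″)) }
    where
    T : Graph
    T = twin (path (3 + k)) zero
    w : Fin (4 + k)
    w = suc (fromℕ (2 + k))

  Complete₄ : Vec (Fin m) 4 → Set
  Complete₄ (b ∷ a ∷ c ∷ d ∷ []) = a ≢ b × ((a ≢ c × a ≢ d) × EndTwinned b c d [])

  complete₄? : (κ : Vec (Fin m) 4) → Dec (Complete₄ κ)
  complete₄? (b ∷ a ∷ c ∷ d ∷ []) =
    ¬? (a Fin.≟ b) ×-dec ((¬? (a Fin.≟ c) ×-dec ¬? (a Fin.≟ d)) ×-dec endTwinned? b c d [])

  proper-twinnedEdge : (κ : Vec (Fin m) 4) → Proper (twinnedPath 2) κ ⇔ Complete₄ κ
  proper-twinnedEdge (b ∷ a ∷ c ∷ d ∷ []) = mk⇔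
    (λ p → let (q , r) , p′ = to (proper-twin T w) p
               s , p″ = to (proper-twin (path 2) zero) p′
           in ≢-sym (r zero (inj₂ (inj₁ refl))) , to avoids-first s , from (endTwinned-path []) (p″ , q , λ j → r (suc j)))
    λ { (a≢b , s , t) → let p″ , q , r = to (endTwinned-path []) t in
        from (proper-twin T w) ((q , λ { zero _ → ≢-sym a≢b ; (suc j) → r j })
                               , from (proper-twin (path 2) zero) (from avoids-first s , p″)) }
    where
    T : Graph
    T = twin (path 2) zero
    w : Fin 3
    w = suc (fromℕ 1)

module _ {m : ℕ} where

  open Coefficients m

  ⊛-scaleˡ : ∀ a f g → ((λ α → a *ℚ f α) ⊛ g) ≗ᶜ λ α → a *ℚ (f ⊛ g) α
  ⊛-scaleˡ a f g α = go (divisors α)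
    where
    go : ∀ βs → ∑ᴸ (λ β → a *ℚ f β *ℚ g (zipWith _∸_ α β)) βs ≡ a *ℚ ∑ᴸ (λ β → f β *ℚ g (zipWith _∸_ α β)) βs
    go []       = sym (ℚ.*-zeroʳ a)
    go (β ∷ βs) = trans (cong₂ _+ℚ_ (ℚ.*-assoc a (f β) _) (go βs)) (sym (ℚ.*-distribˡ-+ a _ _))

  open CommutativeRing (coeffRing m) using () renaming (*-identityˡ to ⊛-identityˡ)

  scalar-⊛ : ∀ a f → ((λ α → a *ℚ 𝟙 m α) ⊛ f) ≗ᶜ λ α → a *ℚ f α
  scalar-⊛ a f α = trans (⊛-scaleˡ a (𝟙 m) f α) (cong (a *ℚ_) (⊛-identityˡ f α))

scalars : ∀ m → ℚ-rawRing -Raw-AlmostCommutative⟶ fromCommutativeRing (coeffRing m)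
scalars m = record
  { ⟦_⟧    = λ a α → a *ℚ 𝟙 m α
  ; +-homo = λ a b α → ℚ.*-distribʳ-+ (𝟙 m α) a b
  ; *-homo = λ a b α → trans (ℚ.*-assoc a b (𝟙 m α)) (sym (scalar-⊛ a (λ α → b *ℚ 𝟙 m α) α))
  ; -‿homo = λ a α → sym (ℚ.neg-distribˡ-* a (𝟙 m α))
  ; 0-homo = λ α → ℚ.*-zeroˡ (𝟙 m α)
  ; 1-homo = λ α → ℚ.*-identityˡ (𝟙 m α)
  }

var : ∀ {m} → Fin m → Vec ℕ m → ℚ
var zero    (zero ∷ α)        = 0ℚ
var zero    (suc zero ∷ α)    = 𝟙 _ α
var zero    (suc (suc _) ∷ α) = 0ℚ
var (suc i) (zero ∷ α)        = var i α
var (suc i) (suc _ ∷ α)       = 0ℚ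

module _ {m : ℕ} where

  open Coefficients (suc m)
  open Coefficients m using () renaming (_⊛_ to _⊛ₘ_)
  open CauchyProduct (coeffRing m)
  private
    module Rₘ = CommutativeRing (coeffRing m)
    slice = slices (isCoeffRing m)

  private
    var-zero-⊛ : ∀ f a α → (var zero ⊛ f) (a ∷ α) ≡ shift (slice f) a α
    var-zero-⊛ f a α = begin
      (var zero ⊛ f) (a ∷ α)
        ≡⟨ ⊛-slices (isCoeffRing m) (var zero) f a α ⟩
      conv (slice (var zero)) (slice f) a α
        ≡⟨ conv-cong {g = slice f} slice-var (λ _ _ → refl) a α ⟩
      conv (shift (constant Rₘ.1#)) (slice f) a α
        ≡⟨ conv-shiftˡ (constant Rₘ.1#) (slice f) a α ⟩
      shift (conv (constant Rₘ.1#) (slice f)) a α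
        ≡⟨ unit a ⟩
      shift (slice f) a α ∎
      where
      open ≡-Reasoning
      slice-var : slice (var zero) ≋ shift (constant Rₘ.1#)
      slice-var zero          α = refl
      slice-var (suc zero)    α = refl
      slice-var (suc (suc a)) α = refl
      unit : ∀ a → shift (conv (constant Rₘ.1#) (slice f)) a α ≡ shift (slice f) a α
      unit zero    = refl
      unit (suc a) = trans (conv-constantˡ Rₘ.1# (slice f) a α) (Rₘ.*-identityˡ (slice f a) α)

  var-zero-⊛-zero : ∀ f α → (var zero ⊛ f) (zero ∷ α) ≡ 0ℚ
  var-zero-⊛-zero f α = var-zero-⊛ f zero α

  var-zero-⊛-suc : ∀ f a α → (var zero ⊛ f) (suc a ∷ α) ≡ f (a ∷ α)
  var-zero-⊛-suc f a α = var-zero-⊛ f (suc a) α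

  var-suc-⊛ : ∀ i f a α → (var (suc i) ⊛ f) (a ∷ α) ≡ (var i ⊛ₘ λ β → f (a ∷ β)) α
  var-suc-⊛ i f a α = begin
    (var (suc i) ⊛ f) (a ∷ α)
      ≡⟨ ⊛-slices (isCoeffRing m) (var (suc i)) f a α ⟩
    conv (slice (var (suc i))) (slice f) a α
      ≡⟨ conv-cong {g = slice f} slice-var (λ _ _ → refl) a α ⟩
    conv (constant (var i)) (slice f) a α
      ≡⟨ conv-constantˡ (var i) (slice f) a α ⟩
    (var i ⊛ₘ slice f a) α ∎
    where
    open ≡-Reasoning
    slice-var : slice (var (suc i)) ≋ constant (var i)
    slice-var zero    α = refl
    slice-var (suc a) α = refl

-- Coefficients of eₖ in the variables other than the i-th one.
ē : ∀ {m} → ℕ → Fin m → Vec ℕ m → ℚ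
ē k       zero    (zero ∷ α)        = e k _ α
ē k       zero    (suc _ ∷ α)       = 0ℚ
ē k       (suc i) (zero ∷ α)        = ē k i α
ē k       (suc i) (suc (suc _) ∷ α) = 0ℚ
ē zero    (suc i) (suc zero ∷ α)    = 0ℚ
ē (suc k) (suc i) (suc zero ∷ α)    = ē k i α

private
  open module Coeffs {m} = Coefficients m using (_⊛_; _≗ᶜ_)

⊛-zeroʳ : ∀ {m} (f : Vec ℕ m → ℚ) → (f ⊛ 𝟘 m) ≗ᶜ 𝟘 m
⊛-zeroʳ {m} = CommutativeRing.zeroʳ (coeffRing m)

e-zero-one : ∀ {m} (α : Vec ℕ m) → e 0 (suc m) (1 ∷ α) ≡ 0ℚ
e-zero-one α = cong (if_then 1ℚ else 0ℚ) (∧-zeroʳ (does (VecAll.all? (_≤? 1) α)))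

e-zero : ∀ {m} → e 0 m ≗ᶜ 𝟙 m
e-zero []                = refl
e-zero (zero ∷ α)        = e-zero α
e-zero (suc zero ∷ α)    = e-zero-one α
e-zero (suc (suc _) ∷ α) = refl

ē-zero : ∀ {m} (i : Fin m) → ē 0 i ≗ᶜ 𝟙 m
ē-zero zero    (zero ∷ α)        = e-zero α
ē-zero zero    (suc _ ∷ α)       = refl
ē-zero (suc i) (zero ∷ α)        = ē-zero i α
ē-zero (suc i) (suc zero ∷ α)    = refl
ē-zero (suc i) (suc (suc _) ∷ α) = refl

e-split : ∀ {m} k (i : Fin m) α → e (suc k) m α ≡ ē (suc k) i α +ℚ (var i ⊛ ē k i) α
e-split k zero (zero ∷ α) =
  sym (trans (cong (e (suc k) _ α +ℚ_) (var-zero-⊛-zero (ē k zero) α)) (ℚ.+-identityʳ _))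
e-split k zero (suc zero ∷ α) =
  sym (trans (cong (0ℚ +ℚ_) (var-zero-⊛-suc (ē k zero) 0 α)) (ℚ.+-identityˡ _))
e-split k zero (suc (suc a) ∷ α) =
  sym (trans (cong (0ℚ +ℚ_) (var-zero-⊛-suc (ē k zero) (suc a) α)) (ℚ.+-identityˡ _))
e-split k (suc i) (zero ∷ α) =
  trans (e-split k i α) (cong (ē (suc k) i α +ℚ_) (sym (var-suc-⊛ i (ē k (suc i)) 0 α)))
e-split zero (suc i) (suc zero ∷ α) =
  sym (trans (cong₂ _+ℚ_ (trans (ē-zero i α) (sym (e-zero α)))
                         (trans (var-suc-⊛ i (ē 0 (suc i)) 1 α) (⊛-zeroʳ (var i) α)))
             (ℚ.+-identityʳ _))
e-split (suc k) (suc i) (suc zero ∷ α) =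
  trans (e-split k i α) (cong (ē (suc k) i α +ℚ_) (sym (var-suc-⊛ i (ē (suc k) (suc i)) 1 α)))
e-split k (suc i) (suc (suc a) ∷ α) =
  sym (trans (cong (0ℚ +ℚ_) (trans (var-suc-⊛ i (ē k (suc i)) (suc (suc a)) α) (⊛-zeroʳ (var i) α)))
             (ℚ.+-identityˡ _))

∑-var-ē : ∀ {m} k (α : Vec ℕ m) → ∑ℚ (λ i → (var i ⊛ ē k i) α) ≡ ℕ⇒ℚ (suc k) *ℚ e (suc k) m α
∑-var-ē k []                = sym (ℚ.*-zeroʳ (ℕ⇒ℚ (suc k)))
∑-var-ē k (zero ∷ α)        = trans (cong₂ _+ℚ_ (var-zero-⊛-zero (ē k zero) α)
                                      (trans (∑ℚ-cong (λ i → var-suc-⊛ i (ē k (suc i)) 0 α)) (∑-var-ē k α)))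
                                    (ℚ.+-identityˡ _)
∑-var-ē {suc m} zero (suc zero ∷ α) = begin
  ∑ℚ (λ i → (var i ⊛ ē 0 i) (1 ∷ α))
    ≡⟨ cong₂ _+ℚ_ (var-zero-⊛-suc (ē 0 zero) 0 α)
         (trans (∑ℚ-cong (λ i → trans (var-suc-⊛ i (ē 0 (suc i)) 1 α) (⊛-zeroʳ (var i) α))) (∑ℚ-zero m)) ⟩
  e 0 m α +ℚ 0ℚ       ≡⟨ ℚ.+-identityʳ _ ⟩
  e 0 m α             ≡⟨ ℚ.*-identityˡ _ ⟨
  1ℚ *ℚ e 0 m α       ∎
  where open ≡-Reasoning
∑-var-ē {suc m} (suc k) (suc zero ∷ α) = begin
  ∑ℚ (λ i → (var i ⊛ ē (suc k) i) (1 ∷ α))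
    ≡⟨ cong₂ _+ℚ_ (var-zero-⊛-suc (ē (suc k) zero) 0 α)
         (trans (∑ℚ-cong (λ i → var-suc-⊛ i (ē (suc k) (suc i)) 1 α)) (∑-var-ē k α)) ⟩
  e (suc k) m α +ℚ ℕ⇒ℚ (suc k) *ℚ e (suc k) m α
    ≡⟨ cong (_+ℚ ℕ⇒ℚ (suc k) *ℚ e (suc k) m α) (ℚ.*-identityˡ (e (suc k) m α)) ⟨
  1ℚ *ℚ e (suc k) m α +ℚ ℕ⇒ℚ (suc k) *ℚ e (suc k) m α
    ≡⟨ ℚ.*-distribʳ-+ (e (suc k) m α) 1ℚ (ℕ⇒ℚ (suc k)) ⟨
  (1ℚ +ℚ ℕ⇒ℚ (suc k)) *ℚ e (suc k) m α
    ≡⟨ cong (_*ℚ e (suc k) m α) (ℕ⇒ℚ-+ 1 (suc k)) ⟨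
  ℕ⇒ℚ (suc (suc k)) *ℚ e (suc k) m α ∎
  where open ≡-Reasoning
∑-var-ē {suc m} k (suc (suc a) ∷ α) = begin
  ∑ℚ (λ i → (var i ⊛ ē k i) (suc (suc a) ∷ α))
    ≡⟨ cong₂ _+ℚ_ (var-zero-⊛-suc (ē k zero) (suc a) α)
         (trans (∑ℚ-cong (λ i → trans (var-suc-⊛ i (ē k (suc i)) (suc (suc a)) α) (⊛-zeroʳ (var i) α))) (∑ℚ-zero m)) ⟩
  0ℚ +ℚ 0ℚ              ≡⟨ ℚ.*-zeroʳ (ℕ⇒ℚ (suc k)) ⟨
  ℕ⇒ℚ (suc k) *ℚ 0ℚ   ∎
  where open ≡-Reasoning

mono : ∀ {m} → Vec ℕ m → Vec ℕ m → ℚ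
mono γ α = if does (Vec.≡-dec _≟_ γ α) then 1ℚ else 0ℚ

mono-zero : ∀ {m} → mono {m} (tabulateᵛ λ _ → 0) ≗ᶜ 𝟙 m
mono-zero []          = refl
mono-zero (zero ∷ α)  = mono-zero α
mono-zero (suc _ ∷ α) = refl

var-⊛-mono : ∀ {m} (c : Fin m) (h : Fin m → ℕ) →
             (var c ⊛ mono (tabulateᵛ h)) ≗ᶜ mono (tabulateᵛ λ i → (if does (i Fin.≟ c) then suc else id) (h i))
var-⊛-mono zero    h (zero ∷ α)  = var-zero-⊛-zero (mono (tabulateᵛ h)) α
var-⊛-mono zero    h (suc a ∷ α) = var-zero-⊛-suc (mono (tabulateᵛ h)) a α
var-⊛-mono (suc c) h (a ∷ α)     = trans (var-suc-⊛ c (mono (tabulateᵛ h)) a α) head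
  where
  head : (var c ⊛ λ β → mono (tabulateᵛ h) (a ∷ β)) α
         ≡ mono (tabulateᵛ λ i → (if does (i Fin.≟ suc c) then suc else id) (h i)) (a ∷ α)
  head with h zero ≡ᵇ a
  ... | true  = var-⊛-mono c (h ∘ suc) α
  ... | false = ⊛-zeroʳ (var c) α

module InVariables (m : ℕ) where

  open CommutativeRing (coeffRing m) using (Carrier; 1#; 0#; *-identityˡ; *-congˡ; *-congʳ; *-cong; zeroˡ)
    renaming (_≈_ to _≋_; _*_ to _∗_; refl to ≋-refl; trans to ≋-trans; sym to ≋-sym)
  open Chromatic (coeffRing m) (scalars m) public
  open import Algebra.Properties.CommutativeMonoid.Sum (CommutativeRing.+-commutativeMonoid (coeffRing m))
    using () renaming (sum to ∑)

  ∑-at : ∀ {n} (f : Fin n → Carrier) α → ∑ f α ≡ ∑ℚ (λ i → f i α)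
  ∑-at {zero}  f α = refl
  ∑-at {suc n} f α = cong (f zero α +ℚ_) (∑-at (f ∘ suc) α)

  open ElementarySymmetric var (λ k → e k m) ē e-zero ē-zero e-split
    (λ k α → trans (∑-at (λ i → var i ∗ ē k i) α)
      (trans (∑-var-ē k α) (sym (scalar-⊛ (ℕ⇒ℚ (suc k)) (e (suc k) m) α)))) public

  weight-content : ∀ {k} (κ : Vec (Fin m) k) → weight κ ≋ mono (content κ)
  weight-content []      α = sym (mono-zero α)
  weight-content (c ∷ κ) = ≋-trans (*-congˡ {var c} (weight-content κ)) (var-⊛-mono c (λ i → count (i Fin.≟_) κ))

  ∑ᴸ-tabulate : ∀ {n} {A : Set} (F : A → ℚ) (g : Fin n → A) → ∑ᴸ F (tabulate g) ≡ ∑ℚ (F ∘ g)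
  ∑ᴸ-tabulate {zero}  F g = refl
  ∑ᴸ-tabulate {suc n} F g = cong (F (g zero) +ℚ_) (∑ᴸ-tabulate F (g ∘ suc))

  colorSum-at : ∀ k (f : Vec (Fin m) k → Carrier) α → colorSum k f α ≡ ∑ᴸ (λ κ → f κ α) (colorings m k)
  colorSum-at zero    f α = sym (ℚ.+-identityʳ _)
  colorSum-at (suc k) f α = begin
    ∑ (λ i → colorSum k (λ κ → f (i ∷ κ))) α
      ≡⟨ ∑-at (λ i → colorSum k (λ κ → f (i ∷ κ))) α ⟩
    ∑ℚ (λ i → colorSum k (λ κ → f (i ∷ κ)) α)
      ≡⟨ ∑ℚ-cong (λ i → colorSum-at k (λ κ → f (i ∷ κ)) α) ⟩
    ∑ℚ (λ i → ∑ᴸ (λ κ → f (i ∷ κ) α) (colorings m k))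
      ≡⟨ ∑ᴸ-tabulate (λ i → ∑ᴸ (λ κ → f (i ∷ κ) α) (colorings m k)) id ⟨
    ∑ᴸ (λ i → ∑ᴸ (λ κ → f (i ∷ κ) α) (colorings m k)) (allFin m)
      ≡⟨ ∑ᴸ-product (λ κ → f κ α) _∷_ (allFin m) (colorings m k) ⟨
    ∑ᴸ (λ κ → f κ α) (colorings m (suc k)) ∎
    where open ≡-Reasoning

  length-filter : ∀ {A : Set} {P : A → Set} (P? : Decidable P) xs →
                  ℕ⇒ℚ (length (filter P? xs)) ≡ ∑ᴸ (λ a → if does (P? a) then 1ℚ else 0ℚ) xs
  length-filter P? []       = refl
  length-filter P? (a ∷ xs) with does (P? a)
  ... | true  = trans (ℕ⇒ℚ-+ 1 (length (filter P? xs))) (cong (1ℚ +ℚ_) (length-filter P? xs))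
  ... | false = trans (length-filter P? xs) (sym (ℚ.+-identityˡ _))

  indicator : ∀ {P : Set} → Dec P → Carrier
  indicator P? = if does P? then 1# else 0#

  indicator-× : ∀ {P Q : Set} (P? : Dec P) (Q? : Dec Q) → indicator (P? ×-dec Q?) ≋ indicator P? ∗ indicator Q?
  indicator-× P? Q? with does P?
  ... | true  = ≋-sym (*-identityˡ (indicator Q?))
  ... | false = ≋-sym (zeroˡ (indicator Q?))

  indicator-≢ : ∀ (i j : Fin m) → indicator (¬? (i Fin.≟ j)) ≋ distinct i j
  indicator-≢ i j with does (i Fin.≟ j)
  ... | true  = ≋-refl {0#}
  ... | false = ≋-refl {1#}

  indicator-⇔ : ∀ {P Q : Set} → P ⇔ Q → (P? : Dec P) (Q? : Dec Q) → indicator P? ≋ indicator Q?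
  indicator-⇔ P⇔Q P? Q? α = cong (λ b → (if b then 1# else 0#) α) (does-⇔ P⇔Q P? Q?)

  X-colorSum : ∀ G → X G m ≋ colorSum (order G) (λ κ → indicator (proper? G κ) ∗ weight κ)
  X-colorSum G α = begin
    X G m α
      ≡⟨ length-filter (λ κ → proper? G κ ×-dec Vec.≡-dec _≟_ (content κ) α) (colorings m (order G)) ⟩
    ∑ᴸ (λ κ → if does (proper? G κ) ∧ does (Vec.≡-dec _≟_ (content κ) α) then 1ℚ else 0ℚ) (colorings m (order G))
      ≡⟨ cong (foldr _+ℚ_ 0ℚ) (map-cong term (colorings m (order G))) ⟩
    ∑ᴸ (λ κ → (indicator (proper? G κ) ∗ weight κ) α) (colorings m (order G))
      ≡⟨ colorSum-at (order G) (λ κ → indicator (proper? G κ) ∗ weight κ) α ⟨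
    colorSum (order G) (λ κ → indicator (proper? G κ) ∗ weight κ) α ∎
    where
    open ≡-Reasoning
    term : ∀ κ → (if does (proper? G κ) ∧ does (Vec.≡-dec _≟_ (content κ) α) then 1ℚ else 0ℚ)
                 ≡ (indicator (proper? G κ) ∗ weight κ) α
    term κ with does (proper? G κ)
    ... | true  = sym (trans (*-identityˡ (weight κ) α) (weight-content κ α))
    ... | false = sym (zeroˡ (weight κ) α)

  indicator-endTwinned : ∀ {k} b c d (κ : Vec (Fin m) k) → indicator (endTwinned? b c d κ) ≋ endTwinned b c d κ
  indicator-endTwinned b c d [] = ≋-trans (indicator-× (¬? (c Fin.≟ d)) (¬? (b Fin.≟ c) ×-dec ¬? (b Fin.≟ d)))
    (*-cong (indicator-≢ c d) (≋-trans (indicator-× (¬? (b Fin.≟ c)) (¬? (b Fin.≟ d))) (*-cong (indicator-≢ b c) (indicator-≢ b d))))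
  indicator-endTwinned b c d (i ∷ κ) = ≋-trans (indicator-× (¬? (c Fin.≟ d)) (endTwinned? b d i κ))
    (*-cong (indicator-≢ c d) (indicator-endTwinned b d i κ))

  indicator-bothEnds : ∀ {k} b a c d (κ : Vec (Fin m) k) →
    indicator ((¬? (a Fin.≟ c) ×-dec ¬? (a Fin.≟ d)) ×-dec endTwinned? b c d κ)
    ≋ distinct a c ∗ distinct a d ∗ endTwinned b c d κ
  indicator-bothEnds b a c d κ = ≋-trans (indicator-× (¬? (a Fin.≟ c) ×-dec ¬? (a Fin.≟ d)) (endTwinned? b c d κ))
    (*-cong (≋-trans (indicator-× (¬? (a Fin.≟ c)) (¬? (a Fin.≟ d))) (*-cong (indicator-≢ a c) (indicator-≢ a d)))
            (indicator-endTwinned b c d κ))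

  X-twinnedPath : ∀ k → X (twinnedPath (3 + k)) m ≋ num 4 ∗ A k
  X-twinnedPath k = ≋-trans (X-colorSum (twinnedPath (3 + k)))
    (≋-trans (colorSum-cong (5 + k) λ κ → *-congʳ {weight κ} (≋-trans
        (indicator-⇔ (proper-twinnedPath κ) (proper? (twinnedPath (3 + k)) κ) (bothTwinned? κ)) (agrees κ)))
      (colorSum-twinned k))
    where
    agrees : ∀ κ → indicator (bothTwinned? κ) ≋ bothTwinned κ
    agrees (b ∷ a ∷ c ∷ d ∷ κ) = indicator-bothEnds b a c d κ

  X-twinnedEdge : X (twinnedPath 2) m ≋ num 24 ∗ e 4 m
  X-twinnedEdge = ≋-trans (X-colorSum (twinnedPath 2))
    (≋-trans (colorSum-cong 4 λ κ → *-congʳ {weight κ} (≋-trans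
        (indicator-⇔ (proper-twinnedEdge κ) (proper? (twinnedPath 2) κ) (complete₄? κ)) (agrees κ)))
      colorSum-complete₄)
    where
    agrees : ∀ κ → indicator (complete₄? κ) ≋ complete₄ κ
    agrees (b ∷ a ∷ c ∷ d ∷ []) = ≋-trans
      (indicator-× (¬? (a Fin.≟ b)) ((¬? (a Fin.≟ c) ×-dec ¬? (a Fin.≟ d)) ×-dec endTwinned? b c d []))
      (*-cong (indicator-≢ a b) (indicator-bothEnds b a c d []))

≈-trans : ∀ {f g h} → f ≈ g → g ≈ h → f ≈ h
≈-trans p q m α = trans (p m α) (q m α)

⊗-cong : ∀ {f f′ g g′} → f ≈ f′ → g ≈ g′ → f ⊗ g ≈ f′ ⊗ g′
⊗-cong p q m = R.*-cong (p m) (q m)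

e∏ : List ℕ → Series
e∏ μ = foldr _⊗_ 𝟙 (map e μ)

e∏-↭ : ∀ {μ ν} → μ ↭ ν → e∏ μ ≈ e∏ ν
e∏-↭ ↭-refl        m   = R.refl
e∏-↭ (prep k p)    m   = R.*-congˡ {x = e k m} (e∏-↭ p m)
e∏-↭ {_ ∷ _ ∷ μ} {_ ∷ _ ∷ ν} (swap j k p) m = R.trans (R.sym (R.*-assoc (e j m) (e k m) (e∏ μ m)))
  (R.trans (R.*-cong (R.*-comm (e j m) (e k m)) (e∏-↭ p m)) (R.*-assoc (e k m) (e j m) (e∏ ν m)))
e∏-↭ (↭-trans p q) m α = trans (e∏-↭ p m α) (e∏-↭ q m α)

module Descending = Sort (decTotalOrder ℕ.≤-decTotalOrder)

toPartition : (μ : List ℕ) → All (1 ≤_) μ → Partition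
toPartition μ μ≥1 = record
  { parts      = Descending.sort μ
  ; decreasing = Descending.sort-↗ μ
  ; positive   = All-resp-↭ (↭-sym (Descending.sort-↭ μ)) μ≥1
  }

addTerm : ℚ → Partition → List (ℚ × Partition) → List (ℚ × Partition)
addTerm q μ [] = (q , μ) ∷ []
addTerm q μ ((r , ν) ∷ c) with ≡-dec _≟_ (parts μ) (parts ν)
... | yes _ = (q +ℚ r , ν) ∷ c
... | no  _ = (r , ν) ∷ addTerm q μ c

private
  partsOf : List (ℚ × Partition) → List (List ℕ)
  partsOf = map (parts ∘ proj₂)

addTerm-fresh : ∀ {p} q μ c → p ≢ parts μ → All (p ≢_) (partsOf c) → All (p ≢_) (partsOf (addTerm q μ c))
addTerm-fresh q μ [] p≢μ [] = p≢μ ∷ []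
addTerm-fresh q μ ((r , ν) ∷ c) p≢μ (p≢ν ∷ ps) with ≡-dec _≟_ (parts μ) (parts ν)
... | yes _ = p≢ν ∷ ps
... | no  _ = p≢ν ∷ addTerm-fresh q μ c p≢μ ps

addTerm-unique : ∀ q μ c → Unique (partsOf c) → Unique (partsOf (addTerm q μ c))
addTerm-unique q μ [] u = [] ∷ []
addTerm-unique q μ ((r , ν) ∷ c) (u ∷ us) with ≡-dec _≟_ (parts μ) (parts ν)
... | yes _  = u ∷ us
... | no μ≢ν = addTerm-fresh q μ c (≢-sym μ≢ν) u ∷ addTerm-unique q μ c us

addTerm-nonNeg : ∀ q μ c → 0ℚ ≤ℚ q → All (λ t → 0ℚ ≤ℚ proj₁ t) c → All (λ t → 0ℚ ≤ℚ proj₁ t) (addTerm q μ c)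
addTerm-nonNeg q μ [] 0≤q [] = 0≤q ∷ []
addTerm-nonNeg q μ ((r , ν) ∷ c) 0≤q (0≤r ∷ ps) with ≡-dec _≟_ (parts μ) (parts ν)
... | yes _ = ℚ.+-mono-≤ 0≤q 0≤r ∷ ps
... | no  _ = 0≤r ∷ addTerm-nonNeg q μ c 0≤q ps

combination-addTerm : ∀ q μ c → q • e[ μ ] ⊕ combination c ≈ combination (addTerm q μ c)
combination-addTerm q μ [] m α = refl
combination-addTerm q μ ((r , ν) ∷ c) m α with ≡-dec _≟_ (parts μ) (parts ν)
... | yes μ≡ν = trans (cong (λ p → q *ℚ e∏ p m α +ℚ (r *ℚ e[ ν ] m α +ℚ combination c m α)) μ≡ν)
                 (trans (sym (ℚ.+-assoc (q *ℚ e[ ν ] m α) (r *ℚ e[ ν ] m α) (combination c m α)))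
                        (cong (_+ℚ combination c m α) (sym (ℚ.*-distribʳ-+ (e[ ν ] m α) q r))))
... | no  _   = trans (x∙yz≈y∙xz (q *ℚ e[ μ ] m α) (r *ℚ e[ ν ] m α) (combination c m α))
                      (cong (r *ℚ e[ ν ] m α +ℚ_) (combination-addTerm q μ c m α))

evaluate : List (ℚ × List ℕ) → Series
evaluate t = foldr _⊕_ 𝟘 (map (λ u → proj₁ u • e∏ (proj₂ u)) t)

-- Unlike EPositive, this allows repeated and unsorted monomials, which makes it visibly closed under sums and products.
Positive : Series → Set
Positive f = Σ (List (ℚ × List ℕ)) λ t → All (λ u → 0ℚ ≤ℚ proj₁ u × All (1 ≤_) (proj₂ u)) t × f ≈ evaluate t

positive-≈ : ∀ {f g} → f ≈ g → Positive g → Positive f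
positive-≈ f≈g (t , t≥0 , g≈t) = t , t≥0 , ≈-trans f≈g g≈t

positive⇒EPositive : ∀ {f} → Positive f → EPositive f
positive⇒EPositive (t , t≥0 , f≈t) = let c , (u , t≈c) , c≥0 = collect t t≥0 in c , (u , ≈-trans f≈t t≈c) , c≥0
  where
  collect : ∀ t → All (λ u → 0ℚ ≤ℚ proj₁ u × All (1 ≤_) (proj₂ u)) t → EPositive (evaluate t)
  collect []            []                      = [] , ([] , λ _ _ → refl) , []
  collect ((q , μ) ∷ t) ((0≤q , μ≥1) ∷ t≥0) =
    let c , (u , t≈c) , c≥0 = collect t t≥0
        μ′ = toPartition μ μ≥1
    in addTerm q μ′ c
     , (addTerm-unique q μ′ c u
       , λ m α → trans (cong₂ _+ℚ_ (cong (q *ℚ_) (e∏-↭ (↭-sym (Descending.sort-↭ μ)) m α)) (t≈c m α))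
                       (combination-addTerm q μ′ c m α))
     , addTerm-nonNeg q μ′ c 0≤q c≥0

positive-𝟘 : Positive 𝟘
positive-𝟘 = [] , [] , λ _ _ → refl

positive-⊕ : ∀ {f g} → Positive f → Positive g → Positive (f ⊕ g)
positive-⊕ {f} {g} (t , t≥0 , f≈t) (u , u≥0 , g≈u) =
  t ++ u , ++⁺ t≥0 u≥0 , λ m α → trans (cong₂ _+ℚ_ (f≈t m α) (g≈u m α)) (append t m α)
  where
  append : ∀ t → evaluate t ⊕ evaluate u ≈ evaluate (t ++ u)
  append []            m α = ℚ.+-identityˡ _
  append ((q , μ) ∷ t) m α = trans (ℚ.+-assoc (q *ℚ e∏ μ m α) _ _) (cong (q *ℚ e∏ μ m α +ℚ_) (append t m α))

positive-• : ∀ {q f} → 0ℚ ≤ℚ q → Positive f → Positive (q • f)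
positive-• {q} {f} 0≤q (t , t≥0 , f≈t) = scale t , nonNeg t≥0 , λ m α → trans (cong (q *ℚ_) (f≈t m α)) (scaled t m α)
  where
  scale : List (ℚ × List ℕ) → List (ℚ × List ℕ)
  scale = map λ u → q *ℚ proj₁ u , proj₂ u
  nonNeg : ∀ {t} → All (λ u → 0ℚ ≤ℚ proj₁ u × All (1 ≤_) (proj₂ u)) t →
           All (λ u → 0ℚ ≤ℚ proj₁ u × All (1 ≤_) (proj₂ u)) (scale t)
  nonNeg [] = []
  nonNeg {(r , _) ∷ _} ((0≤r , μ≥1) ∷ t≥0) =
    (ℚ.≤-trans (ℚ.≤-reflexive (sym (ℚ.*-zeroʳ q))) (ℚ.*-monoˡ-≤-nonNeg q {{nonNegative 0≤q}} 0≤r) , μ≥1) ∷ nonNeg t≥0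
  scaled : ∀ t → q • evaluate t ≈ evaluate (scale t)
  scaled []            m α = ℚ.*-zeroʳ q
  scaled ((r , μ) ∷ t) m α = trans (ℚ.*-distribˡ-+ q _ _) (cong₂ _+ℚ_ (sym (ℚ.*-assoc q r _)) (scaled t m α))

positive-e⊗ : ∀ {k f} → 1 ≤ k → Positive f → Positive (e k ⊗ f)
positive-e⊗ {k} {f} 1≤k (t , t≥0 , f≈t) =
  shift t , nonNeg t≥0 , λ m → R.trans (R.*-congˡ {x = e k m} (f≈t m)) (shifted t m)
  where
  shift : List (ℚ × List ℕ) → List (ℚ × List ℕ)
  shift = map (map₂ (k ∷_))
  nonNeg : ∀ {t} → All (λ u → 0ℚ ≤ℚ proj₁ u × All (1 ≤_) (proj₂ u)) t →
           All (λ u → 0ℚ ≤ℚ proj₁ u × All (1 ≤_) (proj₂ u)) (shift t)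
  nonNeg []                  = []
  nonNeg ((0≤r , μ≥1) ∷ t≥0) = (0≤r , 1≤k ∷ μ≥1) ∷ nonNeg t≥0
  shifted : ∀ t → e k ⊗ evaluate t ≈ evaluate (shift t)
  shifted []            m α = R.zeroʳ (e k m) α
  shifted ((r , μ) ∷ t) m α = trans (R.distribˡ (e k m) (λ α → r *ℚ e∏ μ m α) (evaluate t m) α)
    (cong₂ _+ℚ_ (trans (R.*-comm (e k m) (λ α → r *ℚ e∏ μ m α) α)
                  (trans (⊛-scaleˡ r (e∏ μ m) (e k m) α) (cong (r *ℚ_) (R.*-comm (e∏ μ m) (e k m) α))))
                (shifted t m α))

positive-⊗ : ∀ {f g} → Positive f → Positive g → Positive (f ⊗ g)
positive-⊗ {f} {g} (t , t≥0 , f≈t) g≥0 = positive-≈ (⊗-cong {g = g} f≈t (λ _ _ → refl)) (go t t≥0)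
  where
  times : ∀ μ → All (1 ≤_) μ → Positive (e∏ μ ⊗ g)
  times []      []           = positive-≈ (λ m → R.*-identityˡ (g m)) g≥0
  times (k ∷ μ) (1≤k ∷ μ≥1) = positive-≈ (λ m → R.*-assoc (e k m) (e∏ μ m) (g m)) (positive-e⊗ 1≤k (times μ μ≥1))
  go : ∀ t → All (λ u → 0ℚ ≤ℚ proj₁ u × All (1 ≤_) (proj₂ u)) t → Positive (evaluate t ⊗ g)
  go []            []                  = positive-≈ (λ m → R.zeroˡ (g m)) positive-𝟘
  go ((q , μ) ∷ t) ((0≤q , μ≥1) ∷ t≥0) = positive-≈
    (λ m α → trans (R.distribʳ (g m) (λ α → q *ℚ e∏ μ m α) (evaluate t m) α)
                   (cong (_+ℚ (evaluate t ⊗ g) m α) (⊛-scaleˡ q (e∏ μ m) (g m) α)))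
    (positive-⊕ (positive-• 0≤q (times μ μ≥1)) (go t t≥0))

positive-𝟙 : Positive 𝟙
positive-𝟙 = (1ℚ , []) ∷ [] , (ℚ.nonNegative⁻¹ 1ℚ , []) ∷ []
           , λ m α → sym (trans (ℚ.+-identityʳ _) (ℚ.*-identityˡ _))

positive-e : ∀ k → Positive (e (suc k))
positive-e k = positive-≈ (λ m → R.sym (R.*-identityʳ (e (suc k) m))) (positive-e⊗ (s≤s z≤n) positive-𝟙)

numeral : ℕ → Series
numeral k = ℕ⇒ℚ k • 𝟙

positive-numeral : ∀ k → Positive (numeral k)
positive-numeral k = positive-• (ℚ.nonNegative⁻¹ (ℕ⇒ℚ k) {{ℚ.normalize-nonNeg k 1}}) positive-𝟙

quarter : ℕ → Series
quarter k m = InVariables.A m k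

remainder : ℕ → Series
remainder k m = InVariables.C m k

convolution : (ℕ → Series) → (ℕ → Series) → ℕ → Series
convolution f g k m = CauchyProduct.conv (coeffRing m) (λ i → f i m) (λ i → g i m) k

positive-convolution : ∀ (f g : ℕ → Series) k → (∀ i → Positive (f i)) → (∀ {i} → i ≤ k → Positive (g i)) →
                       Positive (convolution f g k)
positive-convolution f g zero    f≥0 g≥0 = positive-≈ (λ _ _ → refl) (positive-⊗ (f≥0 0) (g≥0 z≤n))
positive-convolution f g (suc k) f≥0 g≥0 = positive-≈ (λ _ _ → refl) (positive-⊕ (positive-⊗ (f≥0 0) (g≥0 ℕ.≤-refl))
  (positive-convolution (f ∘ suc) g k (f≥0 ∘ suc) (λ i≤k → g≥0 (ℕ.m≤n⇒m≤1+n i≤k))))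

private
  coeff : ℕ → Series
  coeff i = numeral (2 + i) ⊗ e (3 + i)

  positive-quarter : ∀ k → Positive (remainder k) → Positive (quarter k)
  positive-quarter k C≥0 = positive-≈ (λ m → InVariables.A-split m k) (positive-⊕ C≥0
    (positive-⊕ (positive-⊗ (linear 5) (positive-e (4 + k)))
      (positive-⊕ (positive-⊗ (positive-⊗ (linear 1) (positive-e (2 + k))) (positive-e 1))
                  (positive-⊗ (positive-⊗ (linear 3) (positive-e (3 + k))) (positive-e 0)))))
    where
    linear : ∀ j → Positive (numeral j ⊕ numeral k)
    linear j = positive-⊕ (positive-numeral j) (positive-numeral k)

positive-remainder : ∀ k → Positive (remainder k)
positive-remainder = <-rec (Positive ∘ remainder) step
  where
  step : ∀ k → (∀ {i} → i < k → Positive (remainder i)) → Positive (remainder k)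
  step 0 _ = positive-≈ (λ m → InVariables.C₀ m) positive-𝟘
  step 1 _ = positive-≈ (λ m → InVariables.C₁ m) (positive-⊗ (positive-⊗ (positive-numeral 6) (positive-e 2)) (positive-e 2))
  step 2 _ = positive-≈ (λ m → InVariables.C₂ m) (positive-⊕
    (positive-⊗ (positive-⊗ (positive-⊗ (positive-numeral 4) (positive-e 2)) (positive-e 2)) (positive-e 0))
    (positive-⊗ (positive-⊗ (positive-numeral 17) (positive-e 3)) (positive-e 2)))
  step (suc (suc (suc k))) IH = positive-≈ (λ m → InVariables.C-recurrence m k)
    (positive-⊕ (positive-⊕ (positive-⊕ (positive-⊕
      (positive-convolution coeff quarter k (λ i → positive-⊗ (positive-numeral (2 + i)) (positive-e (2 + i)))
        (λ {i} i≤k → positive-quarter i (IH (s≤s (ℕ.m≤n⇒m≤1+n (ℕ.m≤n⇒m≤1+n i≤k))))))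
      (positive-⊗ (positive-⊗ (linear 3 4) (positive-e (4 + k))) (positive-e 2)))
      (positive-⊗ (positive-⊗ (positive-⊗ (linear 2 3) (positive-e (3 + k))) (positive-e 2)) (positive-e 0)))
      (positive-⊗ (positive-⊗ (linear 4 3) (positive-e (3 + k))) (positive-e 3)))
      (positive-⊗ (positive-e 1) (IH (ℕ.n≤1+n (2 + k)))))
    where
    linear : ∀ i j → Positive (numeral i ⊗ (numeral j ⊕ numeral k))
    linear i j = positive-⊗ (positive-numeral i) (positive-⊕ (positive-numeral j) (positive-numeral k))

·-numeral : ∀ k f → k · f ≈ numeral k ⊗ f
·-numeral k f m α = sym (scalar-⊛ (ℕ⇒ℚ k) (f m) α)

quarter-X : ∀ k → ¼ • X (twinnedPath (3 + k)) ≈ quarter k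
quarter-X k m α = trans (cong (¼ *ℚ_) (trans (InVariables.X-twinnedPath m k α) (scalar-⊛ (ℕ⇒ℚ 4) (quarter k m) α)))
  (trans (sym (ℚ.*-assoc ¼ (ℕ⇒ℚ 4) (quarter k m α))) (ℚ.*-identityˡ (quarter k m α)))

sum-convolution : ∀ k (f g : ℕ → Series) →
  foldr _⊕_ 𝟘 (applyUpTo (λ i → f i ⊗ g (3 + k ∸ i)) (suc k)) ≈ convolution f (g ∘ (3 +_)) k
sum-convolution zero    f g m α = ℚ.+-identityʳ _
sum-convolution (suc k) f g m α = cong ((f 0 ⊗ g (4 + k)) m α +ℚ_) (sum-convolution k (f ∘ suc) g m α)

Σ-convolution : ∀ k → ¼ • Σ[ 3 ⋯ 3 + k ] (λ j → (j ∸ 1) · e j ⊗ X (twinnedPath (6 + k ∸ j))) ≈ convolution coeff quarter k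
Σ-convolution k m = begin
  (¼ • Σ[ 3 ⋯ 3 + k ] (λ j → (j ∸ 1) · e j ⊗ X (twinnedPath (6 + k ∸ j)))) m
    ≈⟨ (λ α → cong (λ l → ¼ *ℚ foldr _⊕_ 𝟘 l m α) (map-upTo (λ i → (2 + i) · e (3 + i) ⊗ X (twinnedPath (3 + k ∸ i))) (suc k))) ⟩
  (¼ • foldr _⊕_ 𝟘 (applyUpTo (λ i → (2 + i) · e (3 + i) ⊗ X (twinnedPath (3 + k ∸ i))) (suc k))) m
    ≈⟨ (λ α → cong (¼ *ℚ_) (sum-convolution k (λ i → (2 + i) · e (3 + i)) (X ∘ twinnedPath) m α)) ⟩
  (¼ • convolution (λ i → (2 + i) · e (3 + i)) (λ i → X (twinnedPath (3 + i))) k) m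
    ≈⟨ (λ α → sym (scalar-⊛ ¼ (convolution (λ i → (2 + i) · e (3 + i)) (λ i → X (twinnedPath (3 + i))) k m) α)) ⟩
  ¼𝟙 R.* convolution (λ i → (2 + i) · e (3 + i)) (λ i → X (twinnedPath (3 + i))) k m
    ≈⟨ conv-*ʳ ¼𝟙 (λ i → ((2 + i) · e (3 + i)) m) (λ i → X (twinnedPath (3 + i)) m) k ⟨
  conv (λ i → ((2 + i) · e (3 + i)) m) (λ i → ¼𝟙 R.* X (twinnedPath (3 + i)) m) k
    ≈⟨ conv-cong (λ i → ·-numeral (2 + i) (e (3 + i)) m)
         (λ i → R.trans (scalar-⊛ ¼ (X (twinnedPath (3 + i)) m)) (quarter-X i m)) k ⟩
  convolution coeff quarter k m ∎
  where
  open import Relation.Binary.Reasoning.Setoid (R.setoid {m})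
  open CauchyProduct (coeffRing m)
  ¼𝟙 : R.Carrier {m}
  ¼𝟙 = (¼ • 𝟙) m

recurrence-rhs : ℕ → Series
recurrence-rhs n =
  ¼ • Σ[ 3 ⋯ n ∸ 3 ] (λ j → (j ∸ 1) · e j ⊗ X (twinnedPath (n ∸ j)))
  ⊕ (n + 2) · e (n + 2)
  ⊕ n · e (n + 1) ⊗ e 1
  ⊕ (3 * (n ∸ 2)) · e (n ∸ 1) ⊗ e 3
  ⊕ (2 * (n ∸ 3)) · e (n ∸ 2) ⊗ e 3 ⊗ e 1
  ⊕ (4 * (n ∸ 3)) · e (n ∸ 2) ⊗ e 4
  ⊕ e 2 ⊗ (¼ • X (twinnedPath (n ∸ 2))
            ⊖ 2 · e n
            ⊖ (n ∸ 4) · e (n ∸ 2) ⊗ e 2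
            ⊖ (n ∸ 2) · e (n ∸ 1) ⊗ e 1)

rhs≈quarter : ∀ k → recurrence-rhs (6 + k) ≈ quarter (3 + k)
rhs≈quarter k m = R.trans
  (R.+-cong (R.+-cong (R.+-cong (R.+-cong (R.+-cong (R.+-cong
    (Σ-convolution k m)
    (shifted 8 (6 + k + 2) (ℕ.+-comm (6 + k) 2)))
    (R.*-congʳ {x = e 1 m} (R.trans (·-numeral (6 + k) (e (6 + k + 1)) m)
      (R.*-cong (num-+ 6 k) (λ α → cong (λ j → e j m α) (ℕ.+-comm (6 + k) 1))))))
    (R.*-congʳ {x = e 3 m} (product 3 4 (5 + k))))
    (R.*-congʳ {x = e 1 m} (R.*-congʳ {x = e 3 m} (product 2 3 (4 + k)))))
    (R.*-congʳ {x = e 4 m} (product 4 3 (4 + k))))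
    (R.*-congˡ {x = e 2 m} (R.+-cong (R.+-cong (R.+-cong
      (quarter-X (1 + k) m)
      (R.-‿cong (·-numeral 2 (e (6 + k)) m)))
      (R.-‿cong (R.*-congʳ {x = e 2 m} (linear 2 (4 + k)))))
      (R.-‿cong (R.*-congʳ {x = e 1 m} (linear 4 (5 + k)))))))
  (R.sym (A-recurrence k))
  where
  open InVariables m
  linear : ∀ a i → ((a + k) · e i) m R.≈ (num a R.+ num k) R.* e i m
  linear a i = R.trans (·-numeral (a + k) (e i) m) (R.*-congʳ {x = e i m} (num-+ a k))
  product : ∀ a b i → ((a * (b + k)) · e i) m R.≈ num a R.* (num b R.+ num k) R.* e i m
  product a b i = R.trans (·-numeral (a * (b + k)) (e i) m)
    (R.*-congʳ {x = e i m} (R.trans (num-* a (b + k)) (R.*-congˡ {x = num a} (num-+ b k))))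
  shifted : ∀ a i → i ≡ a + k → (i · e i) m R.≈ (num a R.+ num k) R.* e (a + k) m
  shifted a i refl = linear a (a + k)

proposition4p3 :
  (∀ (n : ℕ) → 6 ≤ n →
    let rhs = ¼ • Σ[ 3 ⋯ n ∸ 3 ] (λ j → (j ∸ 1) · e j ⊗ X (twinnedPath (n ∸ j)))
              ⊕ (n + 2) · e (n + 2)
              ⊕ n · e (n + 1) ⊗ e 1
              ⊕ (3 * (n ∸ 2)) · e (n ∸ 1) ⊗ e 3
              ⊕ (2 * (n ∸ 3)) · e (n ∸ 2) ⊗ e 3 ⊗ e 1
              ⊕ (4 * (n ∸ 3)) · e (n ∸ 2) ⊗ e 4
              ⊕ e 2 ⊗ (¼ • X (twinnedPath (n ∸ 2))
                        ⊖ 2 · e n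
                        ⊖ (n ∸ 4) · e (n ∸ 2) ⊗ e 2
                        ⊖ (n ∸ 2) · e (n ∸ 1) ⊗ e 1)
    in (¼ • X (twinnedPath n) ≈ rhs) × EPositive rhs)
  × (X (twinnedPath 2) ≈ 24 · e 4)
  × (X (twinnedPath 3) ≈ 4 · e 3 ⊗ e 2 ⊕ 12 · e 4 ⊗ e 1 ⊕ 20 · e 5)
  × (X (twinnedPath 4) ≈ 24 · e 3 ⊗ e 3 ⊕ 8 · e 4 ⊗ e 2 ⊕ 16 · e 5 ⊗ e 1 ⊕ 24 · e 6)
  × (X (twinnedPath 5) ≈ 16 · e 3 ⊗ e 3 ⊗ e 1 ⊕ 68 · e 4 ⊗ e 3 ⊕ 12 · e 5 ⊗ e 2 ⊕ 20 · e 6 ⊗ e 1 ⊕ 28 · e 7)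
proposition4p3 = recurrence , X₂ , X₃ , X₄ , X₅
  where
  recurrence : ∀ n → 6 ≤ n → (¼ • X (twinnedPath n) ≈ recurrence-rhs n) × EPositive (recurrence-rhs n)
  recurrence _ (s≤s (s≤s (s≤s (s≤s (s≤s (s≤s (z≤n {k}))))))) =
      (λ m α → trans (quarter-X (3 + k) m α) (sym (rhs≈quarter k m α)))
    , positive⇒EPositive (positive-≈ (rhs≈quarter k) (positive-quarter (3 + k) (positive-remainder (3 + k))))

  num· : ∀ k i m → numeral k m R.* e i m R.≈ (k · e i) m
  num· k i m = R.sym (·-numeral k (e i) m)

  num·⊗ : ∀ k i j m → numeral k m R.* e i m R.* e j m R.≈ (k · e i ⊗ e j) m
  num·⊗ k i j m = R.*-congʳ {x = e j m} (num· k i m)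

  X₂ : X (twinnedPath 2) ≈ 24 · e 4
  X₂ m = R.trans (InVariables.X-twinnedEdge m) (num· 24 4 m)

  X₃ : X (twinnedPath 3) ≈ 4 · e 3 ⊗ e 2 ⊕ 12 · e 4 ⊗ e 1 ⊕ 20 · e 5
  X₃ m = R.trans (InVariables.X-twinnedPath m 0) (R.trans (InVariables.4A₀ m)
    (R.+-cong (R.+-cong (num·⊗ 4 3 2 m) (num·⊗ 12 4 1 m)) (num· 20 5 m)))

  X₄ : X (twinnedPath 4) ≈ 24 · e 3 ⊗ e 3 ⊕ 8 · e 4 ⊗ e 2 ⊕ 16 · e 5 ⊗ e 1 ⊕ 24 · e 6
  X₄ m = R.trans (InVariables.X-twinnedPath m 1) (R.trans (InVariables.4A₁ m)
    (R.+-cong (R.+-cong (R.+-cong (num·⊗ 24 3 3 m) (num·⊗ 8 4 2 m)) (num·⊗ 16 5 1 m)) (num· 24 6 m)))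

  X₅ : X (twinnedPath 5) ≈ 16 · e 3 ⊗ e 3 ⊗ e 1 ⊕ 68 · e 4 ⊗ e 3 ⊕ 12 · e 5 ⊗ e 2 ⊕ 20 · e 6 ⊗ e 1 ⊕ 28 · e 7
  X₅ m = R.trans (InVariables.X-twinnedPath m 2) (R.trans (InVariables.4A₂ m)
    (R.+-cong (R.+-cong (R.+-cong (R.+-cong
      (R.*-congʳ {x = e 1 m} (num·⊗ 16 3 3 m)) (num·⊗ 68 4 3 m)) (num·⊗ 12 5 2 m)) (num·⊗ 20 6 1 m)) (num· 28 7 m)))
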